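{- For any two sets $A,B\subseteq\{0,1\}^+$ satisfying $\mathcal F^{\preccurlyeq}_{(A,\mathbf{FPT})}=\mathcal F^{\preccurlyeq}_{(B,\mathbf{FPT})}$ we have $\mathcal F^{\preccurlyeq}_{(A,\mathbf{FPT})}\subseteq\mathcal F^{\preccurlyeq}_{(A\triangle B,\mathbf{FPT})}$; i.e., if for every parameterization $\eta$ we have $(A,\eta)\in\mathbf{FPT}\iff(B,\eta)\in\mathbf{FPT}$, then every $\eta$ with $(A,\eta)\in\mathbf{FPT}$ satisfies $(A\triangle B,\eta)\in\mathbf{FPT}$.
   Context: $A\triangle B=(A\setminus B)\cup(B\setminus A)$. A Turing machine $\Phi$ is a partial decision procedure for $A$ if $\Phi(x)=1\Rightarrow x\in A$ and $\Phi(x)=0\Rightarrow x\notin A$; $\mathrm{dom}(\Phi)=\{x:\Phi(x)\in\{0,1\}\}$. An $O(n^c)$-approximation for $A$ is a partial decision procedure for $A$ halting on all inputs in time $O(n^c)$. A parameter space is a nonempty set $\Omega$ with a reflexive, transitive, directed relation and an injective encoding into $\{0,1\}^+$. A parameterization over $\Omega$ is $\eta\subseteq\{0,1\}^+\times\Omega$ such that for every $x$, $\{k:(x,k)\in\eta\}$ is nonempty and upward closed; $\eta_k=\{x:(x,k)\in\eta\}$. $(A,\eta)\in\mathbf{FPT}$ if there are a constant $c$, a Turing machine $\Psi$ with two inputs and a computable $f$ such that for every parameter value $k$, $\Psi(k,\cdot)$ is an $O(n^c)$-approximation for $A$ with domain $\eta_k$ and running time at most $f(k)\cdot n^c$. $\mathcal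 F^{\preccurlyeq}_{(A,\mathbf{FPT})}$ denotes the set of parameterizations $\eta$ with $(A,\eta)\in\mathbf{FPT}$. -}

module Defs where

open import Data.Nat using (ℕ; zero; suc; _+_; _*_; _^_)
open import Data.Fin using (Fin; zero; suc)
open import Data.Bool using (Bool; true; false)
open import Data.List using (List; []; _∷_; _++_; replicate; length)
open import Data.List.NonEmpty using (List⁺; toList)
open import Data.Maybe using (Maybe; just; nothing)
open import Data.Product using (Σ; _×_; _,_; ∃)
open import Data.Sum using (_⊎_)
open import Relation.Binary.PropositionalEquality using (_≡_)
open import Relation.Nullary using (¬_)
open import Function.Bundles using (_⇔_)

Str : Set
Str = List⁺ Bool

∣_∣ₛ : Str → ℕ
∣ x ∣ₛ = length (toList x)

Lang : Set₁
Lang = Str → Set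

_△_ : Lang → Lang → Lang
(A △ B) x = (A x × ¬ B x) ⊎ (B x × ¬ A x)

-- Deterministic Turing machines (one two-way infinite tape).
-- States: Fin (suc nQ), start state zero.
-- Tape alphabet: Fin (4 + nΓ) with
--   zero = blank, 1 = symbol '0', 2 = symbol '1', 3 = separator '#'.
-- δ q a = nothing  means: halt.

data Move : Set where
  L R S : Move

record TM : Set where
  field
    nQ : ℕ
    nΓ : ℕ
    δ  : Fin (suc nQ) → Fin (4 + nΓ) → Maybe (Fin (suc nQ) × Fin (4 + nΓ) × Move)

module _ (M : TM) where
  open TM M

  Sym : Set
  Sym = Fin (4 + nΓ)

  blank sym0 sym1 sep : Sym
  blank = zero
  sym0  = suc zero
  sym1  = suc (suc zero)
  sep   = suc (suc (suc zero))

  bit : Bool → Sym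
  bit false = sym0
  bit true  = sym1

  bits : List Bool → List Sym
  bits []       = []
  bits (b ∷ bs) = bit b ∷ bits bs

  -- configuration: state, reversed left part, scanned symbol, right part
  record Config : Set where
    constructor cfg
    field
      state : Fin (suc nQ)
      left  : List Sym
      head  : Sym
      right : List Sym

  initial : List Sym → Config
  initial []      = cfg zero [] blank []
  initial (a ∷ w) = cfg zero [] a w

  moveL : List Sym → Sym → List Sym → Config → Config
  moveL []      a r c = cfg (Config.state c) [] blank (a ∷ r)
  moveL (b ∷ l) a r c = cfg (Config.state c) l b (a ∷ r)

  moveR : List Sym → Sym → List Sym → Config → Config
  moveR l a []      c = cfg (Config.state c) (a ∷ l) blank []
  moveR l a (b ∷ r) c = cfg (Config.state c) (a ∷ l) b r

  apply : Fin (suc nQ) → Sym → Move → List Sym → List Sym → Config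
  apply q a L l r = moveL l a r (cfg q [] blank [])
  apply q a R l r = moveR l a r (cfg q [] blank [])
  apply q a S l r = cfg q l a r

  step : Config → Config
  step c@(cfg q l a r) with δ q a
  ... | nothing            = c
  ... | just (q' , a' , m) = apply q' a' m l r

  exec : ℕ → Config → Config
  exec zero    c = c
  exec (suc t) c = exec t (step c)

  Halted : Config → Set
  Halted (cfg q l a r) = δ q a ≡ nothing

  readOut : List Sym → List Sym
  readOut []            = []
  readOut (zero  ∷ _)   = []
  readOut (suc s ∷ w)   = suc s ∷ readOut w

  output : Config → List Sym
  output (cfg q l a r) = readOut (a ∷ r)

  HaltsWithin : ℕ → List Sym → Set
  HaltsWithin t w = Halted (exec t (initial w))

  HaltsWith : List Sym → List Sym → Set
  HaltsWith w o = ∃ λ t → HaltsWithin t w × output (exec t (initial w)) ≡ o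

record ParamSpace : Set₁ where
  field
    Carrier  : Set
    _≼_      : Carrier → Carrier → Set
    ≼-refl   : ∀ k → k ≼ k
    ≼-trans  : ∀ {i j k} → i ≼ j → j ≼ k → i ≼ k
    directed : ∀ i j → Σ Carrier λ k → (i ≼ k) × (j ≼ k)
    nonempty : Carrier
    enc      : Carrier → Str
    enc-inj  : ∀ {i j} → enc i ≡ enc j → i ≡ j

record Parameterization (Ω : ParamSpace) : Set₁ where
  open ParamSpace Ω
  field
    rel       : Str → Carrier → Set
    total     : ∀ x → Σ Carrier λ k → rel x k
    upClosed  : ∀ {x k k'} → rel x k → k ≼ k' → rel x k'

Computable : (Ω : ParamSpace) → (ParamSpace.Carrier Ω → ℕ) → Set
Computable Ω f = Σ TM λ M →
  ∀ k → HaltsWith M (bits M (toList (ParamSpace.enc Ω k)))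
                    (replicate (f k) (sym1 M))

-- (A , η) ∈ FPT
--
-- Ψ(k , x) is run on input  enc(k) # x .  For every parameter value k,
-- Ψ(k , ·) halts on every x within f(k) · |x|^c steps, is a partial
-- decision procedure for A (output 1 ⇒ x ∈ A, output 0 ⇒ x ∉ A),
-- and its domain {x : output ∈ {0,1}} is exactly η_k.

module _ (Ω : ParamSpace) where
  open ParamSpace Ω

  pairInput : (Ψ : TM) → Carrier → Str → List (Sym Ψ)
  pairInput Ψ k x = bits Ψ (toList (enc k)) ++ (sep Ψ ∷ bits Ψ (toList x))

  FPT : Lang → Parameterization Ω → Set
  FPT A η = Σ ℕ λ c → Σ TM λ Ψ → Σ (Carrier → ℕ) λ f →
    Computable Ω f ×
    (∀ k x →
      let t   = f k * (∣ x ∣ₛ ^ c)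
          out = output Ψ (exec Ψ t (initial Ψ (pairInput Ψ k x)))
      in HaltsWithin Ψ t (pairInput Ψ k x)
         × (out ≡ (sym1 Ψ ∷ []) → A x)
         × (out ≡ (sym0 Ψ ∷ []) → ¬ A x)
         × (Parameterization.rel η x k ⇔ (out ≡ (sym0 Ψ ∷ []) ⊎ out ≡ (sym1 Ψ ∷ []))))

{-# OPTIONS --safe #-}

-- FPT is closed under symmetric difference for a common parameterization η, and the hypothesis
-- turns a witness for A into one for B. To decide A △ B, run both machines in turn on the same
-- input. Each tape cell holds one symbol for either machine; an untouched input symbol stands
-- for itself on both lanes, so nothing has to be copied and the overhead does not depend on the
-- length of the parameter. The start cell is marked, and the state remembers on which side of it
-- the head is, so that walking back costs no more steps than were made. The total time is at most
-- 2 t₁ + 2 t₂ + 12.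
-- A computable bound for it comes from the same construction applied to the machines computing f₁
-- and f₂: the written part of the tape has some length m ≥ max (f₁ k) (f₂ k), and m ≥ 1; replacing
-- each of its cells by sixteen ones yields 16 m, and
-- 2 f₁ n^c₁ + 2 f₂ n^c₂ + 12 ≤ 16 m n^(c₁ + c₂).

module Submission where

open import Defs
open import Data.Bool using (Bool; true; false; if_then_else_; _xor_)
open import Data.Fin using (Fin; zero; suc; toℕ; fromℕ; inject₁; combine; remQuot; splitAt; join; _↑ˡ_)
open import Data.Fin.Patterns
open import Data.Fin.Properties using (2↔Bool; remQuot-combine; splitAt-join; toℕ-inject₁; toℕ-fromℕ)
open import Data.List using (List; []; _∷_; _++_; _ʳ++_; map; length; replicate)
open import Data.List.NonEmpty using (toList)
open import Data.List.Properties using (length-map; length-++; length-ʳ++; length-replicate; map-∘; map-id; map-cong; map-++; ++-assoc; map-replicate; ++-identityʳ; ++-ʳ++; ʳ++-ʳ++; ∷-injective)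
open import Data.List.Relation.Unary.All as All using (All; []; _∷_)
open import Data.List.Relation.Unary.All.Properties as All using (++⁺; replicate⁺)
open import Data.Maybe as Maybe using (Maybe; just; nothing; zipWith)
open import Data.Nat using (ℕ; zero; suc; pred; _+_; _*_; _^_; _≤_; z≤n; s≤s)
open import Data.Nat.Properties
open import Data.Nat.Solver using (module +-*-Solver)
open import Data.Product using (_×_; _,_; ∃; proj₁; proj₂)
open import Data.Sum using (_⊎_; inj₁; inj₂; [_,_])
open import Data.Unit using (⊤; tt)
open import Function using (_∘_; id; const)
open import Function.Bundles using (_⇔_; mk⇔; Equivalence; Inverse)
open import Relation.Binary.PropositionalEquality using (_≡_; refl; sym; trans; cong; cong₂; subst; module ≡-Reasoning)
open import Relation.Nullary using (¬_; contradiction)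

if-true : ∀ {A : Set} {b} {x y : A} → b ≡ true → (if b then x else y) ≡ x
if-true refl = refl

if-false : ∀ {A : Set} {b} {x y : A} → b ≡ false → (if b then x else y) ≡ y
if-false refl = refl

-- Tapes

record Tape (G : Set) : Set where
  constructor tape
  field
    left  : List G
    head  : G
    right : List G

open Tape

mapT : ∀ {G H : Set} → (G → H) → Tape G → Tape H
mapT φ (tape l a r) = tape (map φ l) (φ a) (map φ r)

write : ∀ {G : Set} → G → Tape G → Tape G
write a (tape l _ r) = tape l a r

load : ∀ {G : Set} → G → List G → List G → Tape G
load ◻ l []      = tape l ◻ []
load ◻ l (a ∷ r) = tape l a r

unload : ∀ {G : Set} → G → List G → List G → Tape G
unload ◻ []      r = tape [] ◻ r
unload ◻ (a ∷ l) r = tape l a r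

move : ∀ {G : Set} → G → Move → Tape G → Tape G
move ◻ L (tape l a r) = unload ◻ l (a ∷ r)
move ◻ R (tape l a r) = load ◻ (a ∷ l) r
move ◻ S T            = T

extent : ∀ {G : Set} → Tape G → ℕ
extent (tape l _ r) = length l + suc (length r)

-- A move past an end adds a blank cell and any other move keeps the number of cells. Hence lengths
-- measured in one phase remain lower bounds in all later ones.
extent-move : ∀ {G : Set} (◻ : G) m T → extent T ≤ extent (move ◻ m T)
extent-move ◻ L (tape [] a r)      = n≤1+n _
extent-move ◻ L (tape (b ∷ l) a r) = ≤-reflexive (sym (+-suc (length l) (suc (length r))))
extent-move ◻ R (tape l a [])      = n≤1+n _
extent-move ◻ R (tape l a (b ∷ r)) = ≤-reflexive (+-suc (length l) (suc (length r)))
extent-move ◻ S T                  = ≤-refl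

mapT-load : ∀ {G H : Set} (φ : G → H) {◻ ◼} → φ ◻ ≡ ◼ → ∀ l r
  → mapT φ (load ◻ l r) ≡ load ◼ (map φ l) (map φ r)
mapT-load φ refl l []      = refl
mapT-load φ refl l (b ∷ r) = refl

mapT-move : ∀ {G H : Set} (φ : G → H) {◻ ◼} → φ ◻ ≡ ◼ → ∀ m T
  → mapT φ (move ◻ m T) ≡ move ◼ m (mapT φ T)
mapT-move φ refl L (tape [] a r)      = refl
mapT-move φ refl L (tape (b ∷ l) a r) = refl
mapT-move φ refl R (tape l a r)       = mapT-load φ refl (a ∷ l) r
mapT-move φ refl S T                  = refl

mapT-∘ : ∀ {G H K : Set} (ψ : H → K) (φ : G → H) T → mapT ψ (mapT φ T) ≡ mapT (ψ ∘ φ) T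
mapT-∘ ψ φ (tape l a r) = cong₂ (λ l r → tape l (ψ (φ a)) r) (sym (map-∘ l)) (sym (map-∘ r))

-- Reading past the end yields the blank, so lists that differ only in trailing blanks agree at
-- every index.
at : ∀ {G : Set} → G → List G → ℕ → G
at ◻ []      _       = ◻
at ◻ (a ∷ l) zero    = a
at ◻ (a ∷ l) (suc i) = at ◻ l i

at-map : ∀ {G H : Set} (φ : G → H) (◻ : G) l i → at (φ ◻) (map φ l) i ≡ φ (at ◻ l i)
at-map φ ◻ []      i       = refl
at-map φ ◻ (a ∷ l) zero    = refl
at-map φ ◻ (a ∷ l) (suc i) = at-map φ ◻ l i

infix 4 _≈[_]_

-- Equality of tapes up to trailing blanks at both ends.
record _≈[_]_ {G : Set} (T : Tape G) (◻ : G) (T' : Tape G) : Set where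
  constructor mk≈
  field
    left≈  : ∀ i → at ◻ (left T) i ≡ at ◻ (left T') i
    head≈  : head T ≡ head T'
    right≈ : ∀ i → at ◻ (right T) i ≡ at ◻ (right T') i

open _≈[_]_

≈-refl : ∀ {G : Set} {◻ : G} {T} → T ≈[ ◻ ] T
≈-refl = mk≈ (λ _ → refl) refl (λ _ → refl)

≈-reflexive : ∀ {G : Set} {◻ : G} {T T'} → T ≡ T' → T ≈[ ◻ ] T'
≈-reflexive refl = ≈-refl

≈-trans : ∀ {G : Set} {◻ : G} {T U V} → T ≈[ ◻ ] U → U ≈[ ◻ ] V → T ≈[ ◻ ] V
≈-trans (mk≈ l h r) (mk≈ l' h' r') =
  mk≈ (λ i → trans (l i) (l' i)) (trans h h') (λ i → trans (r i) (r' i))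

at-∷ : ∀ {G : Set} {◻ a b : G} {l l'} → a ≡ b → (∀ i → at ◻ l i ≡ at ◻ l' i)
  → ∀ i → at ◻ (a ∷ l) i ≡ at ◻ (b ∷ l') i
at-∷ p q zero    = p
at-∷ p q (suc i) = q i

≈-load : ∀ {G : Set} {◻ : G} {l l'} r r' → (∀ i → at ◻ l i ≡ at ◻ l' i)
  → (∀ i → at ◻ r i ≡ at ◻ r' i) → load ◻ l r ≈[ ◻ ] load ◻ l' r'
≈-load []      []       p q = mk≈ p refl q
≈-load []      (_ ∷ _)  p q = mk≈ p (q 0) (q ∘ suc)
≈-load (_ ∷ _) []       p q = mk≈ p (q 0) (q ∘ suc)
≈-load (_ ∷ _) (_ ∷ _)  p q = mk≈ p (q 0) (q ∘ suc)

≈-unload : ∀ {G : Set} {◻ : G} l l' {r r'} → (∀ i → at ◻ l i ≡ at ◻ l' i)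
  → (∀ i → at ◻ r i ≡ at ◻ r' i) → unload ◻ l r ≈[ ◻ ] unload ◻ l' r'
≈-unload []      []       p q = mk≈ p refl q
≈-unload []      (_ ∷ _)  p q = mk≈ (p ∘ suc) (p 0) q
≈-unload (_ ∷ _) []       p q = mk≈ (p ∘ suc) (p 0) q
≈-unload (_ ∷ _) (_ ∷ _)  p q = mk≈ (p ∘ suc) (p 0) q

≈-move : ∀ {G : Set} {◻ : G} m {T T'} → T ≈[ ◻ ] T' → move ◻ m T ≈[ ◻ ] move ◻ m T'
≈-move L {tape l _ _} {tape l' _ _} (mk≈ p h q) = ≈-unload l l' p (at-∷ h q)
≈-move R {tape _ _ r} {tape _ _ r'} (mk≈ p h q) = ≈-load r r' (at-∷ h p) q
≈-move S e = e

≈-write : ∀ {G : Set} {◻ : G} a {T T'} → T ≈[ ◻ ] T' → write a T ≈[ ◻ ] write a T'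
≈-write a (mk≈ l h r) = mk≈ l refl r

≈-mapT : ∀ {G H : Set} (φ : G → H) {◻ T T'} → T ≈[ ◻ ] T' → mapT φ T ≈[ φ ◻ ] mapT φ T'
≈-mapT φ {◻} {tape l _ r} {tape l' _ r'} (mk≈ p h q) = mk≈ (lift l l' p) (cong φ h) (lift r r' q)
  where
  lift : ∀ l l' → (∀ i → at ◻ l i ≡ at ◻ l' i)
    → ∀ i → at (φ ◻) (map φ l) i ≡ at (φ ◻) (map φ l') i
  lift l l' e i = trans (at-map φ ◻ l i) (trans (cong φ (e i)) (sym (at-map φ ◻ l' i)))

head-load : ∀ {G : Set} (◻ : G) l r → head (load ◻ l r) ≡ at ◻ r 0
head-load ◻ l []      = refl
head-load ◻ l (_ ∷ _) = refl

-- A head on the right-hand side of a marked cell carries the flag true.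
outward inward : Bool → Move
outward true  = R
outward false = L
inward true  = L
inward false = R

-- Only `≈` can be expected: stepping past an end and back leaves an explicit blank behind.
inward-outward : ∀ {G : Set} (◻ : G) f T → move ◻ (inward f) (move ◻ (outward f) T) ≈[ ◻ ] T
inward-outward ◻ true  (tape l a [])      = mk≈ (λ _ → refl) refl (λ { zero → refl ; (suc _) → refl })
inward-outward ◻ true  (tape l a (_ ∷ _)) = ≈-refl
inward-outward ◻ false (tape [] a r)      = mk≈ (λ { zero → refl ; (suc _) → refl }) refl (λ _ → refl)
inward-outward ◻ false (tape (_ ∷ _) a r) = ≈-refl

-- Position of the head relative to the marked cell

shift : ∀ {G : Set} → G → Bool → ℕ → Tape G → Tape G
shift ◻ f zero    T = T
shift ◻ f (suc n) T = move ◻ (outward f) (shift ◻ f n T)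

-- The side is decided anew only when the head leaves the marked cell; from any other cell a single
-- move cannot cross it.
turn : Bool → Move → Bool → Bool
turn true  L _ = false
turn true  R _ = true
turn true  S f = f
turn false _ f = f

record OnlyHeadMarked {X : Set} (◻ : X) (marked : X → Bool) (T : Tape X) : Set where
  field
    marked-head    : marked (head T) ≡ true
    unmarked-left  : ∀ i → marked (at ◻ (left T) i) ≡ false
    unmarked-right : ∀ i → marked (at ◻ (right T) i) ≡ false

module _ {X : Set} (◻ : X) (marked : X → Bool) {H : Tape X} (home : OnlyHeadMarked ◻ marked H) where
  open OnlyHeadMarked home

  private
    ahead : Bool → Tape X → List X
    ahead true  = right
    ahead false = left

    -- What lies ahead of an outward-moving head is a tail of the original half of the tape, or
    -- empty beyond its end. As `at` also reads blanks, the assumption on `H` includes that `◻` is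
    -- unmarked.
    unmarked-ahead : ∀ f n i → marked (at ◻ (ahead f (shift ◻ f n H)) i) ≡ false
    unmarked-ahead true  zero i = unmarked-right i
    unmarked-ahead false zero i = unmarked-left i
    unmarked-ahead true  (suc n) i with shift ◻ true n H | unmarked-ahead true n
    ... | tape l a []      | p = p 0
    ... | tape l a (_ ∷ _) | p = p (suc i)
    unmarked-ahead false (suc n) i with shift ◻ false n H | unmarked-ahead false n
    ... | tape [] a r      | p = p 0
    ... | tape (_ ∷ _) a r | p = p (suc i)

  unmarked-shift : ∀ f n → marked (head (shift ◻ f (suc n) H)) ≡ false
  unmarked-shift true n with shift ◻ true n H | unmarked-ahead true n
  ... | tape l a []      | p = p 0
  ... | tape l a (_ ∷ _) | p = p 0
  unmarked-shift false n with shift ◻ false n H | unmarked-ahead false n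
  ... | tape [] a r      | p = p 0
  ... | tape (_ ∷ _) a r | p = p 0

  -- Away from the mark the flag tells an inward move, which lowers the distance, from an outward
  -- one, which raises it. At distance 0 both flags are correct, and `turn` picks the one that fits
  -- the move.
  move-shift : ∀ m f n → ∃ λ n' → n' ≤ suc n ×
    move ◻ m (shift ◻ f n H) ≈[ ◻ ] shift ◻ (turn (marked (head (shift ◻ f n H))) m f) n' H
  move-shift L f zero rewrite marked-head = 1 , ≤-refl , ≈-refl
  move-shift R f zero rewrite marked-head = 1 , ≤-refl , ≈-refl
  move-shift S f zero rewrite marked-head = 0 , z≤n , ≈-refl
  move-shift L true  (suc n) rewrite unmarked-shift true n  = n , m≤n+m n 2 , inward-outward ◻ true _
  move-shift L false (suc n) rewrite unmarked-shift false n = suc (suc n) , ≤-refl , ≈-refl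
  move-shift R true  (suc n) rewrite unmarked-shift true n  = suc (suc n) , ≤-refl , ≈-refl
  move-shift R false (suc n) rewrite unmarked-shift false n = n , m≤n+m n 2 , inward-outward ◻ false _
  move-shift S f     (suc n) rewrite unmarked-shift f n     = suc n , n≤1+n _ , ≈-refl

-- Machines over arbitrary state sets and alphabets

Trans : Set → Set → Set
Trans Q G = Q → G → Maybe (Q × G × Move)

-- `exec` idles after halting; here the index counts the steps really made, so that another machine
-- can take over where a run has halted.
data Steps {Q G : Set} (◻ : G) (δ : Trans Q G) : Q → Tape G → ℕ → Q → Tape G → Set where
  done : ∀ {q T} → Steps ◻ δ q T 0 q T
  next : ∀ {q T q' a m t q'' T''} → δ q (head T) ≡ just (q' , a , m)
    → Steps ◻ δ q' (move ◻ m (write a T)) t q'' T'' → Steps ◻ δ q T (suc t) q'' T''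

Halts : {Q G : Set} (◻ : G) (δ : Trans Q G) → Q → Tape G → ℕ → Q → Tape G → Set
Halts ◻ δ q T t q' T' = Steps ◻ δ q T t q' T' × δ q' (head T') ≡ nothing

module _ {Q G : Set} {◻ : G} {δ : Trans Q G} where

  infixr 5 _⟫_

  _⟫_ : ∀ {q T t q' T' u q'' T''} → Steps ◻ δ q T t q' T' → Steps ◻ δ q' T' u q'' T''
    → Steps ◻ δ q T (t + u) q'' T''
  done     ⟫ s' = s'
  next e s ⟫ s' = next e (s ⟫ s')

  extent-Steps : ∀ {q T t q' T'} → Steps ◻ δ q T t q' T' → extent T ≤ extent T'
  extent-Steps done = ≤-refl
  extent-Steps (next {T = T} {a = a} {m} e s) =
    ≤-trans (extent-move ◻ m (write a T)) (extent-Steps s)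

  -- The scanned cell is left out: a move past an end makes it a blank, which `P` may exclude. It
  -- joins the written cells once the head leaves it.
  Written : (G → Set) → Tape G → Set
  Written P T = All P (left T) × All P (right T)

  written-move : ∀ {P : G → Set} m {a} → P a → ∀ T → Written P T → Written P (move ◻ m (write a T))
  written-move L p (tape [] _ r)      (ps , qs)     = [] , p ∷ qs
  written-move L p (tape (_ ∷ l) _ r) (_ ∷ ps , qs) = ps , p ∷ qs
  written-move R p (tape l _ [])      (ps , qs)     = p ∷ ps , []
  written-move R p (tape l _ (_ ∷ r)) (ps , _ ∷ qs) = p ∷ ps , qs
  written-move S p (tape l _ r)       ps            = ps

  written-Steps : ∀ {P : G → Set} → (∀ q g {q' a m} → δ q g ≡ just (q' , a , m) → P a)
    → ∀ {q T t q' T'} → Steps ◻ δ q T t q' T' → Written P T → Written P T'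
  written-Steps w done ps = ps
  written-Steps w (next {q} {T} {m = m} e s) ps =
    written-Steps w s (written-move m (w q (head T) e) T ps)

-- Running two machines in sequence

module _ {Q₁ Q₂ V G : Set} (δ₁ : Trans Q₁ G) (κ : Q₁ → V) (start : Q₂) (δ₂ : V → Trans Q₂ G) where

  private
    -- Halting is replaced by one step in place that starts the second machine, with `κ q` kept in
    -- the state as its parameter. This is the `suc` in `sequence-Halts`.
    relay : Q₁ → G → Maybe (Q₁ × G × Move) → Maybe ((Q₁ ⊎ V × Q₂) × G × Move)
    relay q a nothing             = just (inj₂ (κ q , start) , a , S)
    relay q a (just (q' , b , m)) = just (inj₁ q' , b , m)

  sequence : Trans (Q₁ ⊎ V × Q₂) G
  sequence (inj₁ q)       a = relay q a (δ₁ q a)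
  sequence (inj₂ (v , q)) a = Maybe.map (λ { (q' , b , m) → inj₂ (v , q') , b , m }) (δ₂ v q a)

  module _ {◻ : G} where

    private
      first : ∀ {q T t q' T'} → Steps ◻ δ₁ q T t q' T'
        → Steps ◻ sequence (inj₁ q) T t (inj₁ q') T'
      first done = done
      first (next {q} {T} e s) = next (cong (relay q (head T)) e) (first s)

      second : ∀ {v q T t q' T'} → Steps ◻ (δ₂ v) q T t q' T'
        → Steps ◻ sequence (inj₂ (v , q)) T t (inj₂ (v , q')) T'
      second done = done
      second (next e s) = next (cong (Maybe.map _) e) (second s)

    sequence-Halts : ∀ {q T t q' T' u q'' T''}
      → Halts ◻ δ₁ q T t q' T' → Halts ◻ (δ₂ (κ q')) start T' u q'' T''
      → Halts ◻ sequence (inj₁ q) T (t + suc u) (inj₂ (κ q' , q'')) T''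
    sequence-Halts {q' = q'} {T'} (s , h) (s' , h') =
      first s ⟫ next (cong (relay q' (head T')) h) (second s') , cong (Maybe.map _) h'

-- Exact runs of Turing machines

module _ (M : TM) where
  open TM M

  stateOf : Config M → Fin (suc nQ)
  stateOf (cfg q l a r) = q

  tapeOf : Config M → Tape (Sym M)
  tapeOf (cfg q l a r) = tape l a r

  contents : Tape (Sym M) → List (Sym M)
  contents (tape l a r) = readOut M (a ∷ r)

  tapeOf-initial : ∀ w → tapeOf (initial M w) ≡ load zero [] w
  tapeOf-initial []      = refl
  tapeOf-initial (a ∷ w) = refl

  stateOf-initial : ∀ w → stateOf (initial M w) ≡ zero
  stateOf-initial []      = refl
  stateOf-initial (a ∷ w) = refl

  apply-move : ∀ q a m l b r → stateOf (apply M q a m l r) ≡ q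
    × tapeOf (apply M q a m l r) ≡ move zero m (write a (tape l b r))
  apply-move q a L []      b r       = refl , refl
  apply-move q a L (_ ∷ l) b r       = refl , refl
  apply-move q a R l       b []      = refl , refl
  apply-move q a R l       b (_ ∷ r) = refl , refl
  apply-move q a S l       b r       = refl , refl

  step-just : ∀ {q l a r q' b m} → δ q a ≡ just (q' , b , m)
    → step M (cfg q l a r) ≡ apply M q' b m l r
  step-just e rewrite e = refl

  exec-halted : ∀ t c → Halted M c → exec M t c ≡ c
  exec-halted zero    c               h = refl
  exec-halted (suc t) c@(cfg q l a r) h rewrite h = exec-halted t c h

  -- As `exec` idles on halted configurations, `t` is an upper bound for the number of genuine
  -- steps, not their exact number.
  exec-Halts : ∀ t c → Halted M (exec M t c) → ∃ λ t' → t' ≤ t ×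
    Halts zero δ (stateOf c) (tapeOf c) t' (stateOf (exec M t c)) (tapeOf (exec M t c))
  exec-Halts zero    (cfg q l a r) h = 0 , z≤n , done , h
  exec-Halts (suc t) (cfg q l a r) h with δ q a in e
  ... | nothing rewrite exec-halted t (cfg q l a r) e = 0 , z≤n , done , e
  ... | just (q' , b , m) with apply M q' b m l r | apply-move q' b m l a r | exec-Halts t (apply M q' b m l r)
  ... | c | refl , p | ih with ih h
  ... | t' , t'≤t , s , h' = suc t' , s≤s t'≤t , next e (subst (λ T → Steps _ _ _ T _ _ _) p s) , h'

  initial-Halts : ∀ t w → HaltsWithin M t w → ∃ λ t' → t' ≤ t × ∃ λ q →
    Halts zero δ zero (load zero [] w) t' q (tapeOf (exec M t (initial M w)))
  initial-Halts t w h with exec-Halts t (initial M w) h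
  ... | t' , t'≤ , r rewrite stateOf-initial w | tapeOf-initial w = t' , t'≤ , _ , r

  output-contents : ∀ c → output M c ≡ contents (tapeOf c)
  output-contents (cfg q l a r) = refl

-- Encoding finite sets

-- A retract of a `Fin` suffices, since a simulation only has to recover states and symbols from
-- their codes.
record Finite (A : Set) : Set where
  field
    card        : ℕ
    code        : A → Fin card
    decode      : Fin card → A
    decode-code : ∀ a → decode (code a) ≡ a

open Finite

finite-Fin : ∀ n → Finite (Fin n)
finite-Fin n = record { card = n ; code = id ; decode = id ; decode-code = λ _ → refl }

finite-retract : ∀ {A B : Set} → Finite A → (to : A → B) (from : B → A)
  → (∀ b → to (from b) ≡ b) → Finite B
finite-retract F to from e = record
  { card        = card F
  ; code        = code F ∘ from
  ; decode      = to ∘ decode F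
  ; decode-code = λ b → trans (cong to (decode-code F (from b))) (e b)
  }

finite-⊎ : ∀ {A B : Set} → Finite A → Finite B → Finite (A ⊎ B)
finite-⊎ F G = finite-retract (finite-Fin (card F + card G))
  (Data.Sum.map (decode F) (decode G) ∘ splitAt (card F))
  (join (card F) (card G) ∘ Data.Sum.map (code F) (code G))
  λ s → trans (cong (Data.Sum.map (decode F) (decode G)) (splitAt-join (card F) (card G) (Data.Sum.map (code F) (code G) s))) (inverse s)
  where
  inverse : ∀ s → Data.Sum.map (decode F) (decode G) (Data.Sum.map (code F) (code G) s) ≡ s
  inverse (inj₁ a) = cong inj₁ (decode-code F a)
  inverse (inj₂ b) = cong inj₂ (decode-code G b)

finite-× : ∀ {A B : Set} → Finite A → Finite B → Finite (A × B)
finite-× F G = finite-retract (finite-Fin (card F * card G))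
  (Data.Product.map (decode F) (decode G) ∘ remQuot (card G))
  (λ { (a , b) → combine (code F a) (code G b) })
  λ { (a , b) → trans (cong (Data.Product.map (decode F) (decode G)) (remQuot-combine (code F a) (code G b)))
                      (cong₂ _,_ (decode-code F a) (decode-code G b)) }

finite-Bool : Finite Bool
finite-Bool = finite-retract (finite-Fin 2) (Inverse.to 2↔Bool) (Inverse.from 2↔Bool)
  λ { false → refl ; true → refl }

finite-Maybe : ∀ {A : Set} → Finite A → Finite (Maybe A)
finite-Maybe F = finite-retract (finite-⊎ (finite-Fin 1) F)
  [ const nothing , just ] (λ { nothing → inj₁ 0F ; (just a) → inj₂ a })
  λ { nothing → refl ; (just _) → refl }

-- Compilation to Turing machines

data Glyph (E : Set) : Set where
  raw : Fin 4 → Glyph E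
  ext : E → Glyph E

module Compile {E Q : Set} (finE : Finite E) (finQ : Finite Q) (start : Q) (δ : Trans Q (Glyph E)) where

  glyph : Fin (4 + card finE) → Glyph E
  glyph 0F = raw 0F
  glyph 1F = raw 1F
  glyph 2F = raw 2F
  glyph 3F = raw 3F
  glyph (suc (suc (suc (suc i)))) = ext (decode finE i)

  private
    glyphCode : Glyph E → Fin (4 + card finE)
    glyphCode (raw i) = i ↑ˡ card finE
    glyphCode (ext e) = suc (suc (suc (suc (code finE e))))

    glyph-glyphCode : ∀ g → glyph (glyphCode g) ≡ g
    glyph-glyphCode (raw 0F) = refl
    glyph-glyphCode (raw 1F) = refl
    glyph-glyphCode (raw 2F) = refl
    glyph-glyphCode (raw 3F) = refl
    glyph-glyphCode (ext e)  = cong ext (decode-code finE e)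

    -- Code `zero` is the start state prescribed by `TM`; every state, `start` included, also has a
    -- code of the form `suc`.
    state : Fin (suc (card finQ)) → Q
    state zero    = start
    state (suc i) = decode finQ i

    encode : Maybe (Q × Glyph E × Move) → Maybe (Fin (suc (card finQ)) × Fin (4 + card finE) × Move)
    encode = Maybe.map λ { (q , g , m) → suc (code finQ q) , glyphCode g , m }

  machine : TM
  machine = record { nQ = card finQ ; nΓ = card finE ; δ = λ q s → encode (δ (state q) (glyph s)) }

  private
    tapeG : Config machine → Tape (Glyph E)
    tapeG c = mapT glyph (tapeOf machine c)

    -- The invariant compares state and tape after decoding, which makes the two codes of `start`
    -- interchangeable. The `u` steps allowed beyond `t` are idle.
    Steps-exec : ∀ {q T t q' T' u} c → q ≡ state (stateOf machine c) → T ≡ tapeG c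
      → Steps (raw 0F) δ q T t q' T' → δ q' (head T') ≡ nothing → t ≤ u
      → Halted machine (exec machine u c) × tapeG (exec machine u c) ≡ T'
    Steps-exec {u = u} c@(cfg q l a r) refl refl done h _
      rewrite exec-halted machine u c (cong encode h) = cong encode h , refl
    Steps-exec {u = suc u} (cfg q l a r) refl refl (next {q' = q'} {b} {m} e s) h (s≤s t≤u)
      rewrite step-just machine {q} {l} {a} {r} (cong encode e)
      with apply-move machine (suc (code finQ q')) (glyphCode b) m l a r
    ... | eq , eT = Steps-exec _
      (trans (sym (decode-code finQ q')) (cong state (sym eq)))
      (trans (cong (λ g → move (raw 0F) m (tape (map glyph l) g (map glyph r))) (sym (glyph-glyphCode b)))
        (trans (sym (mapT-move glyph refl m (tape l (glyphCode b) r))) (cong (mapT glyph) (sym eT))))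
      s h t≤u

  Halts-machine : ∀ w {t q' T' u}
    → Halts (raw 0F) δ start (load (raw 0F) [] (map raw w)) t q' T' → t ≤ u
    → let c = exec machine u (initial machine (map (_↑ˡ card finE) w))
      in Halted machine c × mapT glyph (tapeOf machine c) ≡ T'
  Halts-machine w {u = u} (s , h) t≤u =
    Steps-exec (initial machine v) (cong state (sym (stateOf-initial machine v)))
      (trans (cong (load _ []) (sym raw-glyph))
        (trans (sym (mapT-load glyph refl [] v)) (cong (mapT glyph) (sym (tapeOf-initial machine v)))))
      s h t≤u
    where
    v = map (_↑ˡ card finE) w
    raw-glyph : map glyph v ≡ map raw w
    raw-glyph = trans (sym (map-∘ w)) (map-cong (glyph-glyphCode ∘ raw) w)

  private
    glyph-raw : ∀ s i → glyph s ≡ raw i → s ≡ i ↑ˡ card finE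
    glyph-raw 0F _ refl = refl
    glyph-raw 1F _ refl = refl
    glyph-raw 2F _ refl = refl
    glyph-raw 3F _ refl = refl
    glyph-raw (suc (suc (suc (suc i)))) _ ()

  readOut-glyph : ∀ us ws {z} → map glyph ws ≡ map (raw ∘ suc) us ++ raw 0F ∷ z
    → readOut machine ws ≡ map ((_↑ˡ card finE) ∘ suc) us
  readOut-glyph []       (w ∷ ws) e with glyph-raw w 0F (proj₁ (∷-injective e))
  ... | refl = refl
  readOut-glyph (u ∷ us) (w ∷ ws) e with glyph-raw w (suc u) (proj₁ (∷-injective e))
  ... | refl = cong (_ ∷_) (readOut-glyph us ws (proj₂ (∷-injective e)))

  output-glyph : ∀ c us {T z} → mapT glyph (tapeOf machine c) ≡ T
    → head T ∷ right T ≡ map (raw ∘ suc) us ++ raw 0F ∷ z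
    → output machine c ≡ map ((_↑ˡ card finE) ∘ suc) us
  output-glyph (cfg q l a r) us refl e = readOut-glyph us (a ∷ r) e

-- Running a machine on one lane of the tape and returning to the marked cell

Verdict : Set
Verdict = Maybe Bool

candidate : ∀ {n} → Fin (4 + n) → Verdict
candidate 0F = nothing
candidate 1F = just false
candidate 2F = just true
candidate (suc (suc (suc _))) = nothing

confirm : ∀ {n} → Fin (4 + n) → Verdict → Verdict
confirm zero    v = v
confirm (suc _) v = nothing

verdict : ∀ {n} → Tape (Fin (4 + n)) → Verdict
verdict (tape l a r) = confirm (at zero r 0) (candidate a)

-- The output ends before the first blank, so it is a single bit exactly when a bit is scanned and
-- the cell to its right is blank. Inspecting two cells therefore decides it.
output⇔verdict : ∀ M c b → output M c ≡ bit M b ∷ [] ⇔ verdict (tapeOf M c) ≡ just b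
output⇔verdict M (cfg q l a r) b = mk⇔ (to b a r) (from b a r)
  where
  to : ∀ b a r → readOut M (a ∷ r) ≡ bit M b ∷ [] → verdict (tape l a r) ≡ just b
  to true  2F []         refl = refl
  to true  2F (zero ∷ _) refl = refl
  to false 1F []         refl = refl
  to false 1F (zero ∷ _) refl = refl
  from : ∀ b a r → verdict (tape l a r) ≡ just b → readOut M (a ∷ r) ≡ bit M b ∷ []
  from b 0F []         ()
  from b 0F (zero ∷ r) ()
  from b 0F (suc _ ∷ r) ()
  from b 1F []         refl = refl
  from b 1F (zero ∷ r) refl = refl
  from b 2F []         refl = refl
  from b 2F (zero ∷ r) refl = refl
  from b (suc (suc (suc a))) [] ()
  from b (suc (suc (suc a))) (zero ∷ r) ()
  from b (suc (suc (suc a))) (suc _ ∷ r) ()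

-- Reading stops at the first blank, so the output fits into every list that represents the same
-- cells, however many trailing blanks it stores.
length-readOut : ∀ M w w' → (∀ i → at zero w i ≡ at zero w' i) → length (readOut M w) ≤ length w'
length-readOut M []          w'       e = z≤n
length-readOut M (zero ∷ w)  w'       e = z≤n
length-readOut M (suc a ∷ w) []       e with e 0
... | ()
length-readOut M (suc a ∷ w) (_ ∷ w') e = s≤s (length-readOut M w w' (e ∘ suc))

-- A lens whose complement `Rest` holds everything outside the lane. The mark is read off `Rest`, so
-- writing in the lane can neither move nor erase it.
record Lane {G : Set} (◻ : G) (n : ℕ) : Set₁ where
  field
    Rest      : Set
    get       : G → Fin (4 + n)
    put       : Fin (4 + n) → G → G
    rest      : G → Rest
    marked    : Rest → Bool
    get-blank : get ◻ ≡ zero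
    get-put   : ∀ a g → get (put a g) ≡ a
    rest-put  : ∀ a g → rest (put a g) ≡ rest g

RunState : TM → Set
RunState M = (Fin (suc (TM.nQ M)) × Bool) ⊎ ((Verdict × Bool) ⊎ (Verdict × Bool))

pattern running  q f = inj₁ (q , f)
pattern checking v f = inj₂ (inj₁ (v , f))
pattern homing   v f = inj₂ (inj₂ (v , f))

finite-⊤ : Finite ⊤
finite-⊤ = finite-retract (finite-Fin 1) (const tt) (const 0F) (λ _ → refl)

finite-Verdict : Finite Verdict
finite-Verdict = finite-Maybe finite-Bool

finite-RunState : ∀ M → Finite (RunState M)
finite-RunState M = finite-⊎ (finite-× (finite-Fin _) finite-Bool) (finite-⊎ flagged flagged)
  where flagged = finite-× finite-Verdict finite-Bool

-- By `run-Halts`, runs end in a homing state; `nothing` is only a default elsewhere.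
reached : ∀ {M} → RunState M → Verdict
reached (running _ _)  = nothing
reached (checking _ _) = nothing
reached (homing v _)   = v

module Run (M : TM) {G : Set} (◻ : G) (lane : Lane ◻ (TM.nΓ M)) where
  open Lane lane

  private
    -- The lane keeps its symbol, but the cell is rewritten by `put`. In this way every visited
    -- cell, even a blank one, becomes a composite symbol.
    touch : G → G
    touch g = put (get g) g

    simulate : Bool → G → Maybe (Fin (suc (TM.nQ M)) × Sym M × Move) → Maybe (RunState M × G × Move)
    simulate f g nothing             =
      just (checking (candidate (get g)) (turn (marked (rest g)) R f) , touch g , R)
    simulate f g (just (q' , a , m)) =
      just (running q' (turn (marked (rest g)) m f) , put a g , m)

  run : Trans (RunState M) G
  run (running q f)  g = simulate f g (TM.δ M q (get g))
  run (checking v f) g = just (homing (confirm (get g) v) f , touch g , S)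
  run (homing v f)   g = if marked (rest g) then nothing else just (homing v f , touch g , inward f)

  run-writes : ∀ (P : G → Set) → (∀ a g → P (put a g))
    → ∀ q g {q' b m} → run q g ≡ just (q' , b , m) → P b
  run-writes P p (running q f) g e with TM.δ M q (get g)
  run-writes P p (running q f) g refl | nothing          = p _ _
  run-writes P p (running q f) g refl | just (_ , _ , _) = p _ _
  run-writes P p (checking v f) g refl = p _ _
  run-writes P p (homing v f)   g e with marked (rest g)
  run-writes P p (homing v f)   g () | true
  run-writes P p (homing v f)   g refl | false = p _ _

  module _ {H : Tape Rest} (home : OnlyHeadMarked (rest ◻) marked H) where

    private
      At : Bool → ℕ → Tape G → Set
      At f n T = mapT rest T ≈[ rest ◻ ] shift (rest ◻) f n H

      get-move : ∀ {T U g a} m → mapT get T ≈[ zero ] U → get g ≡ a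
        → mapT get (move ◻ m (write g T)) ≈[ zero ] move zero m (write a U)
      get-move {T} {U} {g} m e refl = ≈-trans
        (≈-reflexive (mapT-move get get-blank m (write g T))) (≈-move m (≈-write (get g) e))

      rest-move : ∀ {f n T g} m → At f n T → rest g ≡ rest (head T)
        → mapT rest (move ◻ m (write g T)) ≈[ rest ◻ ] move (rest ◻) m (shift (rest ◻) f n H)
      rest-move {T = T} {g} m e p = ≈-trans
        (≈-reflexive (trans (mapT-move rest refl m (write g T))
          (cong (λ x → move (rest ◻) m (write x (mapT rest T))) p)))
        (≈-move m e)

      At-move : ∀ {f n T g} m → At f n T → rest g ≡ rest (head T)
        → ∃ λ n' → n' ≤ suc n × At (turn (marked (rest (head T))) m f) n' (move ◻ m (write g T))
      At-move {f} {n} m e p with move-shift (rest ◻) marked home m f n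
      ... | n' , n'≤ , s = n' , n'≤ ,
        subst (λ x → _ ≈[ _ ] shift (rest ◻) (turn (marked x) m f) n' H) (sym (head≈ e))
          (≈-trans (rest-move {f} {n} m e p) s)

      -- Seen through `get` the tape follows that of `M`; seen through `rest` only the head moves,
      -- because all writes are made by `put`. Each step adds at most one to the distance from home.
      simulation : ∀ {q U t q' U' f n T} → Steps zero (TM.δ M) q U t q' U'
        → mapT get T ≈[ zero ] U → At f n T
        → ∃ λ f' → ∃ λ n' → ∃ λ T' → Steps ◻ run (running q f) T t (running q' f') T'
          × mapT get T' ≈[ zero ] U' × At f' n' T' × n' ≤ t + n
      simulation done g a = _ , _ , _ , done , g , a , ≤-refl
      simulation {f = f} {n} {T} (next {q} {a = b} {m} {t} e s) g a
        with At-move {g = put b (head T)} m a (rest-put b (head T))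
      ... | n₁ , n₁≤ , a₁
        with simulation s (get-move m g (get-put b (head T))) a₁
      ... | f' , n' , T' , s' , g' , a' , n'≤ = f' , n' , T' ,
        next (trans (cong (λ x → simulate f (head T) (TM.δ M q x)) (head≈ g)) (cong (simulate f (head T)) e)) s' ,
        g' , a' , ≤-trans n'≤ (≤-trans (+-monoʳ-≤ t n₁≤) (≤-reflexive (+-suc t n)))

      return : ∀ v f n T → At f n T
        → ∃ λ T' → Halts ◻ run (homing v f) T n (homing v f) T' × mapT rest T' ≈[ rest ◻ ] H
      return v f zero T a = T , (done , if-true mk) , a
        where
        mk : marked (rest (head T)) ≡ true
        mk = trans (cong marked (head≈ a)) (OnlyHeadMarked.marked-head home)
      return v f (suc n) T a
        with return v f n (move ◻ (inward f) (write (touch (head T)) T))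
               (≈-trans (rest-move {f} {suc n} (inward f) a (rest-put _ _)) (inward-outward (rest ◻) f _))
      ... | T' , (s , h) , a' = T' , (next {T = T} (if-false mk) s , h) , a'
        where
        mk : marked (rest (head T)) ≡ false
        mk = trans (cong marked (head≈ a)) (unmarked-shift (rest ◻) marked home f n)

    -- The time is made up of `t` simulated steps, one step to the right, one step in place that
    -- completes the verdict, and at most `t + 1` steps home.
    run-Halts : ∀ {q U t q' U' T} → Halts zero (TM.δ M) q U t q' U'
      → mapT get T ≈[ zero ] U → mapT rest T ≈[ rest ◻ ] H
      → ∃ λ t' → ∃ λ f → ∃ λ T' → Halts ◻ run (running q true) T t' (homing (verdict U') f) T'
        × t' ≤ 2 * t + 3 × mapT rest T' ≈[ rest ◻ ] H × length (contents M U') ≤ extent T'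
    run-Halts {t = t} {q'} {U'@(tape l a r)} (s , h) g e with simulation {f = true} {0} s g e
    ... | f₁ , n₁ , T₁ , s₁ , g₁ , a₁ , n₁≤ with At-move {g = touch (head T₁)} R a₁ (rest-put _ _)
    ... | n₂ , n₂≤ , a₂
      with return (verdict U') (turn (marked (rest (head T₁))) R f₁) n₂
             (write (touch (head (move ◻ R (write (touch (head T₁)) T₁)))) (move ◻ R (write (touch (head T₁)) T₁)))
             (rest-move {turn (marked (rest (head T₁))) R f₁} {n₂} S a₂ (rest-put _ _))
    ... | T' , (s₃ , h₃) , e₃ = t + suc (suc n₂) , _ , T' , (s₁ ⟫ next halted (next confirmed s₃) , h₃) , bound , e₃ , room
      where
      T₂ : Tape G
      T₂ = move ◻ R (write (touch (head T₁)) T₁)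
      f₂ : Bool
      f₂ = turn (marked (rest (head T₁))) R f₁
      halted : run (running q' f₁) (head T₁) ≡ just (checking (candidate a) f₂ , touch (head T₁) , R)
      halted = trans
        (cong (simulate f₁ (head T₁)) (trans (cong (TM.δ M q') (head≈ g₁)) h))
        (cong (λ x → just (checking (candidate x) f₂ , touch (head T₁) , R)) (head≈ g₁))
      confirmed : run (checking (candidate a) f₂) (head T₂)
        ≡ just (homing (verdict U') f₂ , touch (head T₂) , S)
      confirmed = cong (λ x → just (homing (confirm x (candidate a)) f₂ , touch (head T₂) , S))
        (trans (head≈ (get-move R g₁ (get-put _ (head T₁)))) (head-load zero _ r))
      bound : t + suc (suc n₂) ≤ 2 * t + 3
      bound = begin
        t + suc (suc n₂)            ≤⟨ +-monoʳ-≤ t (s≤s (s≤s (≤-trans n₂≤ (s≤s n₁≤)))) ⟩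
        t + (3 + (t + 0))           ≡⟨ cong (t +_) (+-comm 3 (t + 0)) ⟩
        t + ((t + 0) + 3)           ≡⟨ +-assoc t (t + 0) 3 ⟨
        2 * t + 3                   ∎
        where open ≤-Reasoning
      -- At halting the output occupies cells from the head to the right, all within the visited
      -- segment, and this segment does not shrink on the way home.
      room : length (contents M U') ≤ extent T'
      room = begin
        length (contents M U')           ≤⟨ length-readOut M (a ∷ r) (get (head T₁) ∷ map get (right T₁))
                                              (at-∷ (sym (head≈ g₁)) (λ i → sym (right≈ g₁ i))) ⟩
        suc (length (map get (right T₁))) ≡⟨ cong suc (length-map get (right T₁)) ⟩
        suc (length (right T₁))          ≤⟨ m≤n+m _ (length (left T₁)) ⟩
        extent T₁                        ≤⟨ extent-Steps (next {q = running q' f₁} {T = T₁} halted (next confirmed s₃)) ⟩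
        extent T'                        ∎
        where open ≤-Reasoning

-- Running two machines one after the other on the same input

data Composite (m n : ℕ) : Set where
  X Y  : Composite m n   -- used only for counting cells in stretch
  cell : Fin (4 + m) → Fin (4 + n) → Bool → Composite m n

-- Opaque, so that the coding does not unfold in the types of the compiled machine.
abstract
  finite-Composite : ∀ m n → Finite (Composite m n)
  finite-Composite m n = finite-retract
    (finite-⊎ (finite-Fin 2) (finite-× (finite-Fin (4 + m)) (finite-× (finite-Fin (4 + n)) finite-Bool)))
    (λ { (inj₁ 0F) → X ; (inj₁ 1F) → Y ; (inj₂ (a , b , f)) → cell a b f })
    (λ { X → inj₁ 0F ; Y → inj₁ 1F ; (cell a b f) → inj₂ (a , b , f) })
    (λ { X → refl ; Y → refl ; (cell _ _ _) → refl })

module Dual (M₁ M₂ : TM) where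

  private
    n₁ = TM.nΓ M₁
    n₂ = TM.nΓ M₂

  Symbol : Set
  Symbol = Glyph (Composite n₁ n₂)

  pattern ◻ = raw 0F

  get₁ : Symbol → Sym M₁
  get₁ (raw i)            = i ↑ˡ n₁
  get₁ (ext X)            = zero
  get₁ (ext Y)            = zero
  get₁ (ext (cell a _ _)) = a

  get₂ : Symbol → Sym M₂
  get₂ (raw i)            = i ↑ˡ n₂
  get₂ (ext X)            = zero
  get₂ (ext Y)            = zero
  get₂ (ext (cell _ b _)) = b

  mark : Symbol → Bool
  mark (raw _)            = false
  mark (ext X)            = false
  mark (ext Y)            = false
  mark (ext (cell _ _ f)) = f

  -- The symbols of which the written segment consists when the simulations are over. A composite
  -- cell counts even if both lanes are blank, so `◻` occurs only outside the segment and delimits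
  -- it for `stretch`.
  plain? : Symbol → Bool
  plain? ◻                  = false
  plain? (raw (suc _))      = true
  plain? (ext X)            = false
  plain? (ext Y)            = false
  plain? (ext (cell _ _ _)) = true

  Plain : Symbol → Set
  Plain g = plain? g ≡ true

  lane₁ : Lane ◻ n₁
  lane₁ = record
    { Rest      = Sym M₂ × Bool
    ; get       = get₁
    ; put       = λ a g → ext (cell a (get₂ g) (mark g))
    ; rest      = λ g → get₂ g , mark g
    ; marked    = proj₂
    ; get-blank = refl
    ; get-put   = λ _ _ → refl
    ; rest-put  = λ _ _ → refl
    }

  lane₂ : Lane ◻ n₂
  lane₂ = record
    { Rest      = Sym M₁ × Bool
    ; get       = get₂
    ; put       = λ b g → ext (cell (get₁ g) b (mark g))
    ; rest      = λ g → get₁ g , mark g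
    ; marked    = proj₂
    ; get-blank = refl
    ; get-put   = λ _ _ → refl
    ; rest-put  = λ _ _ → refl
    }

  private
    module Run₁ = Run M₁ ◻ lane₁
    module Run₂ = Run M₂ ◻ lane₂
    open Lane lane₁ using () renaming (rest to rest₁)
    open Lane lane₂ using () renaming (rest to rest₂)

  place : Trans Bool Symbol
  place false g = just (true , ext (cell (get₁ g) (get₂ g) true) , S)
  place true  g = nothing

  private
    input : List (Fin 4) → Tape Symbol
    input w = load ◻ [] (map raw w)

    placed : List (Fin 4) → Tape Symbol
    placed w = write (ext (cell (get₁ (head (input w))) (get₂ (head (input w))) true)) (input w)

    unmarked-raw : ∀ w i → mark (at ◻ (map raw w) i) ≡ false
    unmarked-raw []      i       = refl
    unmarked-raw (a ∷ w) zero    = refl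
    unmarked-raw (a ∷ w) (suc i) = unmarked-raw w i

    onlyHeadMarked-placed : ∀ w → OnlyHeadMarked ◻ mark (placed w)
    onlyHeadMarked-placed w = record
      { marked-head = refl ; unmarked-left = unmarkedˡ w ; unmarked-right = unmarkedʳ w }
      where
      unmarkedˡ : ∀ w i → mark (at ◻ (left (placed w)) i) ≡ false
      unmarkedˡ []      i = refl
      unmarkedˡ (_ ∷ _) i = refl
      unmarkedʳ : ∀ w i → mark (at ◻ (right (placed w)) i) ≡ false
      unmarkedʳ []      i = refl
      unmarkedʳ (_ ∷ w) i = unmarked-raw w i

    onlyHeadMarked-mapT : ∀ {Z : Set} (φ : Symbol → Z) (μ : Z → Bool) → (∀ g → μ (φ g) ≡ mark g)
      → ∀ {T} → OnlyHeadMarked ◻ mark T → OnlyHeadMarked (φ ◻) μ (mapT φ T)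
    onlyHeadMarked-mapT φ μ e {T} o = record
      { marked-head    = trans (e (head T)) marked-head
      ; unmarked-left  = λ i → trans (cong μ (at-map φ ◻ (left T) i)) (trans (e _) (unmarked-left i))
      ; unmarked-right = λ i → trans (cong μ (at-map φ ◻ (right T) i)) (trans (e _) (unmarked-right i))
      }
      where open OnlyHeadMarked o

    -- The mark is a component of `rest₁`, so the tape left by the first run is marked like the one
    -- it started from.
    onlyHeadMarked-rest : ∀ {T T'} → mapT rest₁ T ≈[ rest₁ ◻ ] mapT rest₁ T'
      → OnlyHeadMarked ◻ mark T' → OnlyHeadMarked ◻ mark T
    onlyHeadMarked-rest {T} {T'} e o = record
      { marked-head    = trans (cong proj₂ (head≈ e)) marked-head
      ; unmarked-left  = λ i → trans (same (left T) (left T') (left≈ e) i) (unmarked-left i)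
      ; unmarked-right = λ i → trans (same (right T) (right T') (right≈ e) i) (unmarked-right i)
      }
      where
      open OnlyHeadMarked o
      same : ∀ l l' → (∀ i → at (rest₁ ◻) (map rest₁ l) i ≡ at (rest₁ ◻) (map rest₁ l') i)
        → ∀ i → mark (at ◻ l i) ≡ mark (at ◻ l' i)
      same l l' p i = cong proj₂ (trans (sym (at-map rest₁ ◻ l i)) (trans (p i) (at-map rest₁ ◻ l' i)))

    plain-marked : ∀ g → mark g ≡ true → Plain g
    plain-marked (ext (cell _ _ _)) _ = refl

    plain-raw : ∀ w → All (λ (i : Fin 4) → ¬ i ≡ 0F) w → All Plain (map raw w)
    plain-raw []          []       = []
    plain-raw (0F ∷ w)    (p ∷ ps) = contradiction refl p
    plain-raw (suc i ∷ w) (p ∷ ps) = refl ∷ plain-raw w ps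

    written-placed : ∀ w → All (λ (i : Fin 4) → ¬ i ≡ 0F) w
      → All Plain (left (placed w)) × All Plain (right (placed w))
    written-placed []      p        = [] , []
    written-placed (_ ∷ w) (_ ∷ ps) = [] , plain-raw w ps

    get-input : ∀ {Z : Set} (φ : Symbol → Z) (ψ : Fin 4 → Z) → (∀ i → φ (raw i) ≡ ψ i)
      → ∀ w → mapT φ (input w) ≡ load (ψ 0F) [] (map ψ w)
    get-input φ ψ e w = trans (mapT-load φ (e 0F) [] (map raw w))
      (cong (load _ []) (trans (sym (map-∘ w)) (map-cong e w)))

    Outcome₁ : List (Fin 4) → ℕ → Tape (Sym M₁) → Set
    Outcome₁ w t U = ∃ λ t' → ∃ λ f → ∃ λ T
      → Halts ◻ Run₁.run (running zero true) (placed w) t' (homing (verdict U) f) T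
        × t' ≤ 2 * t + 3 × mapT rest₁ T ≈[ rest₁ ◻ ] mapT rest₁ (placed w)
        × length (contents M₁ U) ≤ extent T

    Outcome₂ : Tape Symbol → ℕ → Tape (Sym M₂) → Set
    Outcome₂ T₁ t U = ∃ λ t' → ∃ λ f → ∃ λ T
      → Halts ◻ Run₂.run (running zero true) T₁ t' (homing (verdict U) f) T
        × t' ≤ 2 * t + 3 × mapT rest₂ T ≈[ rest₂ ◻ ] mapT rest₂ T₁
        × length (contents M₂ U) ≤ extent T

    phase₁ : ∀ w {t q U} → Halts zero (TM.δ M₁) zero (load zero [] (map (_↑ˡ n₁) w)) t q U
      → Outcome₁ w t U
    phase₁ w h = Run₁.run-Halts {H = mapT rest₁ (placed w)} home {T = placed w} h
      (≈-reflexive (get-input get₁ (_↑ˡ n₁) (λ _ → refl) w)) ≈-refl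
      where
      home : OnlyHeadMarked (rest₁ ◻) proj₂ (mapT rest₁ (placed w))
      home = onlyHeadMarked-mapT rest₁ proj₂ (λ _ → refl) {placed w} (onlyHeadMarked-placed w)

    phase₂ : ∀ w {T₁ t q U} → mapT rest₁ T₁ ≈[ rest₁ ◻ ] mapT rest₁ (placed w)
      → Halts zero (TM.δ M₂) zero (load zero [] (map (_↑ˡ n₂) w)) t q U → Outcome₂ T₁ t U
    phase₂ w {T₁} e h = Run₂.run-Halts {H = mapT rest₂ T₁} home {T = T₁} h intact ≈-refl
      where
      home : OnlyHeadMarked (rest₂ ◻) proj₂ (mapT rest₂ T₁)
      home = onlyHeadMarked-mapT rest₂ proj₂ (λ _ → refl) {T₁}
        (onlyHeadMarked-rest {T₁} {placed w} e (onlyHeadMarked-placed w))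
      -- The second lane is the other component of `rest₁`; the first run has not altered the input
      -- there.
      intact : mapT get₂ T₁ ≈[ zero ] load zero [] (map (_↑ˡ n₂) w)
      intact = ≈-trans (≈-reflexive (sym (mapT-∘ proj₁ rest₁ T₁)))
        (≈-trans (≈-mapT proj₁ e) (≈-reflexive (trans (mapT-∘ proj₁ rest₁ (placed w))
          (get-input get₂ (_↑ˡ n₂) (λ _ → refl) w))))

    -- The constant 10 consists of one step placing the mark, three handovers, and the overhead of 3
    -- for each of the two runs.
    dual-time : ∀ {t₁ t₂ a b} u → a ≤ 2 * t₁ + 3 → b ≤ 2 * t₂ + 3
      → 1 + suc (a + suc (b + suc u)) ≤ 2 * t₁ + 2 * t₂ + (10 + u)
    dual-time {t₁} {t₂} {a} {b} u a≤ b≤ = begin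
      1 + suc (a + suc (b + suc u))
        ≤⟨ s≤s (s≤s (+-mono-≤ a≤ (s≤s (+-monoˡ-≤ (suc u) b≤)))) ⟩
      1 + suc ((2 * t₁ + 3) + suc ((2 * t₂ + 3) + suc u))
        ≡⟨ solve 3 (λ x y u → con 2 :+ ((x :+ con 3) :+ (con 1 :+ ((y :+ con 3) :+ (con 1 :+ u))))
             := x :+ y :+ (con 10 :+ u)) refl (2 * t₁) (2 * t₂) u ⟩
      2 * t₁ + 2 * t₂ + (10 + u) ∎
      where
      open ≤-Reasoning
      open +-*-Solver

  module _ {F : Set} (finF : Finite F) (start : F) (finish : Verdict → Verdict → Trans F Symbol) where

    State : Set
    State = Bool ⊎ ⊤ × (RunState M₁ ⊎ Verdict × (RunState M₂ ⊎ Verdict × F))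

    abstract
      finite-State : Finite State
      finite-State = finite-⊎ finite-Bool (finite-× finite-⊤ (finite-⊎ (finite-RunState M₁)
        (finite-× finite-Verdict (finite-⊎ (finite-RunState M₂) (finite-× finite-Verdict finF)))))

    private
      stage₂ : Verdict → Trans (RunState M₂ ⊎ Verdict × F) Symbol
      stage₂ v = sequence Run₂.run (reached {M₂}) start (finish v)

      stage₁ : Trans (RunState M₁ ⊎ Verdict × (RunState M₂ ⊎ Verdict × F)) Symbol
      stage₁ = sequence Run₁.run (reached {M₁}) (inj₁ (running zero true)) stage₂

    dual : Trans State Symbol
    dual = sequence place (const tt) (inj₁ (running zero true)) (const stage₁)

    -- The tape `T` on which `finish` starts is produced before any run of `finish` is asked for, so
    -- that this run may be chosen depending on `T`. Plainness and extent are recorded for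
    -- `stretch`.
    dual-Halts : ∀ w {t₁ q₁ U₁ t₂ q₂ U₂}
      → All (λ (i : Fin 4) → ¬ i ≡ 0F) w
      → Halts zero (TM.δ M₁) zero (load zero [] (map (_↑ˡ n₁) w)) t₁ q₁ U₁
      → Halts zero (TM.δ M₂) zero (load zero [] (map (_↑ˡ n₂) w)) t₂ q₂ U₂
      → ∃ λ T → (All Plain (left T) × Plain (head T) × All Plain (right T))
        × length (contents M₁ U₁) ≤ extent T × length (contents M₂ U₂) ≤ extent T
        × (∀ {u q' T'} → Halts ◻ (finish (verdict U₁) (verdict U₂)) start T u q' T'
            → ∃ λ t → ∃ λ q'' → t ≤ 2 * t₁ + 2 * t₂ + (10 + u)
              × Halts ◻ dual (inj₁ false) (load ◻ [] (map raw w)) t q'' T')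
    dual-Halts w {t₁} {U₁ = U₁} {t₂} {U₂ = U₂} nz h₁ h₂ = assemble (phase₁ w h₁)
      where
      assemble : Outcome₁ w t₁ U₁ → _
      assemble (a , f₁ , T₁ , r₁ , a≤ , e₁ , room₁) = conclude (phase₂ w e₁ h₂)
        where
        conclude : Outcome₂ T₁ t₂ U₂ → _
        conclude (b , f₂ , T₂ , r₂ , b≤ , e₂ , room₂) =
          T₂ , (proj₁ written , plain-marked (head T₂) marked-T₂ , proj₂ written) ,
          ≤-trans room₁ (extent-Steps (proj₁ r₂)) , room₂ ,
          λ {u} {_} {_} h → 1 + suc (a + suc (b + suc u)) , _ , dual-time {t₁} {t₂} u a≤ b≤ ,
            sequence-Halts place (const tt) _ _ (next refl done , refl)
              (sequence-Halts Run₁.run (reached {M₁}) _ stage₂ r₁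
                (sequence-Halts Run₂.run (reached {M₂}) start (finish (verdict U₁)) r₂ h))
          where
          written : All Plain (left T₂) × All Plain (right T₂)
          written = written-Steps (Run₂.run-writes Plain (λ _ _ → refl)) (proj₁ r₂)
            (written-Steps (Run₁.run-writes Plain (λ _ _ → refl)) (proj₁ r₁) (written-placed w nz))
          -- `written` does not cover the scanned cell; it is plain because the head is back on the
          -- mark, which only a composite cell carries.
          marked-T₂ : mark (head T₂) ≡ true
          marked-T₂ = trans (cong proj₂ (head≈ e₂)) (cong proj₂ (head≈ e₁))

  -- Writing the exclusive or of the two verdicts

  -- After `raw ∘ suc` the values are the symbols 0, 1 and the separator. The separator is no bit
  -- and so stands for an undefined answer.
  conclusion : Verdict → Fin 3
  conclusion nothing      = 2F
  conclusion (just false) = 0F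
  conclusion (just true)  = 1F

  announce : Verdict → Verdict → Trans (Fin 3) Symbol
  announce v w 0F g = just (1F , raw (suc (conclusion (zipWith _xor_ v w))) , R)
  -- The blank cuts the output down to the one symbol just written.
  announce v w 1F g = just (2F , ◻ , L)
  announce v w 2F g = nothing

  announce-Halts : ∀ v w T → ∃ λ l → ∃ λ r → Halts ◻ (announce v w) 0F T 2 2F
    (tape l (raw (suc (conclusion (zipWith _xor_ v w)))) (◻ ∷ r))
  announce-Halts v w (tape l a [])      = l , _ , next refl (next refl done) , refl
  announce-Halts v w (tape l a (_ ∷ _)) = l , _ , next refl (next refl done) , refl

  -- Stretching the written part of the tape by a constant factor

  Stage : Set
  Stage = Fin 7 ⊎ Fin 15

  pattern rewind   = inj₁ 0F
  pattern loop     = inj₁ 1F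
  pattern seek     = inj₁ 2F
  pattern recoil   = inj₁ 3F
  pattern final    = inj₁ 4F
  pattern fill     = inj₁ 5F
  pattern stop     = inj₁ 6F
  pattern append i = inj₂ i

  blank? : Symbol → Bool
  blank? ◻             = true
  blank? (raw (suc _)) = false
  blank? (ext _)       = false

  X? : Symbol → Bool
  X? (ext X)            = true
  X? (ext Y)            = false
  X? (ext (cell _ _ _)) = false
  X? (raw _)            = false

  -- Each plain symbol is turned into X, and fifteen copies of Y are appended for it at the right end.
  stretch : Trans Stage Symbol
  stretch rewind           g = if blank? g then just (loop , g , R) else just (rewind , g , L)
  stretch loop             g = if plain? g then just (seek , ext X , R) else just (final , g , S)
  stretch seek             g = if blank? g then just (append (fromℕ 14) , g , S) else just (seek , g , R)
  stretch (append zero)    g = just (recoil , ext Y , S)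
  stretch (append (suc i)) g = just (append (inject₁ i) , ext Y , R)
  stretch recoil           g = if X? g then just (loop , g , R) else just (recoil , g , L)
  stretch final            g = if blank? g then just (fill , g , L) else just (final , g , R)
  stretch fill             g = if blank? g then just (stop , g , R) else just (fill , raw 2F , L)
  stretch stop             g = nothing

  private
    infix 4 _⟶_

    -- The number of steps is hidden: `Computable` imposes no time bound.
    record _⟶_ (c c' : Stage × Tape Symbol) : Set where
      constructor steps
      field
        {time} : ℕ
        run-of : Steps ◻ stretch (proj₁ c) (proj₂ c) time (proj₁ c') (proj₂ c')

    stay : ∀ {c} → c ⟶ c
    stay = steps done

    infixr 5 _then_

    _then_ : ∀ {c c' c''} → c ⟶ c' → c' ⟶ c'' → c ⟶ c''
    steps s then steps s' = steps (s ⟫ s')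

    one : ∀ {q T q' a m} → stretch q (head T) ≡ just (q' , a , m) → (q , T) ⟶ (q' , move ◻ m (write a T))
    one e = steps (next e done)

    departing : ∀ {q T T' c} → T ≡ T' → (q , T) ⟶ c → (q , T') ⟶ c
    departing refl s = s

    arriving : ∀ {q T T' c} → T ≡ T' → c ⟶ (q , T) → c ⟶ (q , T')
    arriving refl s = s

    sweepR : ∀ q w l → All (λ g → stretch q g ≡ just (q , g , R)) w
      → (q , load ◻ l w) ⟶ (q , load ◻ (w ʳ++ l) [])
    sweepR q []      l []       = stay
    sweepR q (a ∷ w) l (e ∷ es) = one {T = tape l a w} e then sweepR q w (a ∷ l) es

    -- The head meets `w` from its right end, so the induction hypothesis is run first and the
    -- leftmost symbol `a` is treated last.
    sweepL : ∀ q (φ : Symbol → Symbol) w l r → All (λ g → stretch q g ≡ just (q , φ g , L)) w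
      → (q , unload ◻ (w ʳ++ l) r) ⟶ (q , unload ◻ l (map φ w ++ r))
    sweepL q φ []      l r []       = stay
    sweepL q φ (a ∷ w) l r (e ∷ es) = sweepL q φ w (a ∷ l) r es then one {T = tape l a (map φ w ++ r)} e

    sweepL-id : ∀ q w l r → All (λ g → stretch q g ≡ just (q , g , L)) w
      → (q , unload ◻ (w ʳ++ l) r) ⟶ (q , unload ◻ l (w ++ r))
    sweepL-id q w l r es =
      arriving (cong (λ v → unload ◻ l (v ++ r)) (map-id w)) (sweepL q id w l r es)

    -- State `append i` still has `toℕ i + 1` symbols to write. The recursion is on `n`, as
    -- `inject₁ i` is no structural part of `suc i`. The last `Y` is written in place and remains
    -- scanned.
    appendY : ∀ n i l → toℕ i ≡ n
      → (append i , load ◻ l []) ⟶ (recoil , unload ◻ (replicate (suc n) (ext Y) ʳ++ l) [])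
    appendY zero    zero    l e = one {T = load ◻ l []} refl
    appendY (suc n) (suc i) l e = one {T = load ◻ l []} refl
      then appendY n (inject₁ i) (ext Y ∷ l) (trans (toℕ-inject₁ i) (cong pred e))

    -- The possible cells to the right of the symbol being treated. None is `◻`, so `seek` reaches
    -- the right end; none is `X`, so `recoil` stops at the `X` just written.
    Unspent : Symbol → Set
    Unspent g = Plain g ⊎ g ≡ ext Y

    blank-plain : ∀ g → Plain g → blank? g ≡ false
    blank-plain (raw (suc _))      _ = refl
    blank-plain (ext (cell _ _ _)) _ = refl

    blank-unspent : ∀ {g} → Unspent g → blank? g ≡ false
    blank-unspent (inj₁ p)    = blank-plain _ p
    blank-unspent (inj₂ refl) = refl

    X-unspent : ∀ {g} → Unspent g → X? g ≡ false
    X-unspent {raw _}            _ = refl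
    X-unspent {ext Y}            _ = refl
    X-unspent {ext (cell _ _ _)} _ = refl
    X-unspent {ext X} (inj₁ ())
    X-unspent {ext X} (inj₂ ())

    fifteenY : List Symbol
    fifteenY = replicate 15 (ext Y)

    allY : All (_≡ ext Y) fifteenY
    allY = replicate⁺ 15 refl

    round : ∀ a w l → Plain a → All Unspent w
      → (loop , load ◻ l (a ∷ w)) ⟶ (loop , load ◻ (ext X ∷ l) (w ++ fifteenY))
    round a w l p ps = one {loop} {tape l a w} (if-true p)
      then sweepR seek w (ext X ∷ l) (All.map (if-false ∘ blank-unspent) ps)
      then one {seek} {load ◻ (w ʳ++ ext X ∷ l) []} refl
      then appendY 14 (fromℕ 14) (w ʳ++ ext X ∷ l) (toℕ-fromℕ 14)
      then back
      then one {recoil} {tape l (ext X) (w ++ fifteenY)} refl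
      where
      back : (recoil , unload ◻ (fifteenY ʳ++ w ʳ++ ext X ∷ l) []) ⟶ (recoil , tape l (ext X) (w ++ fifteenY))
      back = departing (cong (λ v → unload ◻ v []) (++-ʳ++ w {fifteenY} {ext X ∷ l}))
        (arriving (cong (tape l (ext X)) (++-identityʳ (w ++ fifteenY)))
          (sweepL-id recoil (w ++ fifteenY) (ext X ∷ l) []
            (All.map (if-false ∘ X-unspent) (++⁺ ps (All.map inj₂ allY)))))

    -- Generalised over the `Y`s already appended, since each round lengthens the block behind the
    -- untreated symbols.
    rounds : ∀ us ys l → All Plain us → All (_≡ ext Y) ys
      → ∃ λ ys' → All (_≡ ext Y) ys' × length ys' ≡ length us * 15 + length ys
        × (loop , load ◻ l (us ++ ys)) ⟶ (loop , load ◻ (replicate (length us) (ext X) ʳ++ l) ys')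
    rounds []       ys l []       qs = ys , qs , refl , stay
    rounds (a ∷ us) ys l (p ∷ ps) qs
      with rounds us (ys ++ fifteenY) (ext X ∷ l) ps (++⁺ qs allY)
    ... | ys' , qs' , len , s = ys' , qs' , trans len count ,
      round a (us ++ ys) l p (++⁺ (All.map inj₁ ps) (All.map inj₂ qs))
        then departing (cong (load ◻ (ext X ∷ l)) (sym (++-assoc us ys fifteenY))) s
      where
      count : length us * 15 + length (ys ++ fifteenY) ≡ 15 + length us * 15 + length ys
      count = trans (cong (length us * 15 +_) (length-++ ys))
        (solve 2 (λ u y → u :+ (y :+ con 15) := con 15 :+ u :+ y) refl (length us * 15) (length ys))
        where open +-*-Solver

    leave : ∀ l ys → All (_≡ ext Y) ys → (loop , load ◻ l ys) ⟶ (final , load ◻ l ys)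
    leave l []       []         = one {loop} {load ◻ l []} refl
    leave l (_ ∷ ys) (refl ∷ _) = one {loop} {tape l (ext Y) ys} refl

    -- The blank on the left is the one where `rewind` turned and stops `fill`; the blank on the
    -- right is where `final` turned and terminates the output.
    wrapUp : ∀ n ys → All (_≡ ext Y) ys
      → (loop , load ◻ (replicate n (ext X) ʳ++ ◻ ∷ []) ys)
        ⟶ (stop , load ◻ (◻ ∷ []) (map (const (raw 2F)) (replicate n (ext X) ++ ys) ++ ◻ ∷ []))
    wrapUp n ys qs = leave _ ys qs
      then sweepR final ys _ (All.map (λ { refl → refl }) qs)
      then one {final} {load ◻ (ys ʳ++ xs ʳ++ ◻ ∷ []) []} refl
      then back
      then one {fill} {tape [] ◻ (map (const (raw 2F)) (xs ++ ys) ++ ◻ ∷ [])} refl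
      where
      xs = replicate n (ext X)
      back : (fill , unload ◻ (ys ʳ++ xs ʳ++ ◻ ∷ []) (◻ ∷ []))
        ⟶ (fill , tape [] ◻ (map (const (raw 2F)) (xs ++ ys) ++ ◻ ∷ []))
      back = departing (cong (λ v → unload ◻ v (◻ ∷ [])) (++-ʳ++ xs {ys} {◻ ∷ []}))
        (sweepL fill (const (raw 2F)) (xs ++ ys) (◻ ∷ []) (◻ ∷ [])
          (++⁺ (replicate⁺ n refl) (All.map (λ { refl → refl }) qs)))

    map-const : ∀ (a : Symbol) (w : List Symbol) → map (const a) w ≡ replicate (length w) a
    map-const a []      = refl
    map-const a (_ ∷ w) = cong (a ∷_) (map-const a w)

    All-ʳ++ : ∀ {P : Symbol → Set} {xs ys} → All P xs → All P ys → All P (xs ʳ++ ys)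
    All-ʳ++ []       qs = qs
    All-ʳ++ (p ∷ ps) qs = All-ʳ++ ps (p ∷ qs)

    ʳ++-involutive : ∀ (xs : List Symbol) → (xs ʳ++ []) ʳ++ [] ≡ xs
    ʳ++-involutive xs = trans (ʳ++-ʳ++ xs) (++-identityʳ xs)

  stretch-Halts : ∀ T → All Plain (left T) × Plain (head T) × All Plain (right T)
    → ∃ λ t → Halts ◻ stretch rewind T t stop (load ◻ (◻ ∷ []) (replicate (16 * extent T) (raw 2F) ++ ◻ ∷ []))
  stretch-Halts (tape l a r) (ps , p , qs) with rounds (((a ∷ l) ʳ++ []) ++ r) [] (◻ ∷ [])
                                                  (++⁺ (All-ʳ++ (p ∷ ps) []) qs) []
  ... | ys , ysY , len , s = _⟶_.time path , _⟶_.run-of path , refl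
    where
    -- The whole written segment from left to right; the left half is stored in reverse.
    us = ((a ∷ l) ʳ++ []) ++ r
    xs = replicate (length us) (ext X)
    length-us : length us ≡ extent (tape l a r)
    length-us = begin
      length us                            ≡⟨ length-++ ((a ∷ l) ʳ++ []) ⟩
      length ((a ∷ l) ʳ++ []) + length r   ≡⟨ cong (_+ length r) (length-ʳ++ (a ∷ l)) ⟩
      suc (length l) + 0 + length r        ≡⟨ solve 2 (λ l r → con 1 :+ l :+ con 0 :+ r := l :+ (con 1 :+ r)) refl (length l) (length r) ⟩
      length l + suc (length r)            ∎
      where
      open ≡-Reasoning
      open +-*-Solver
    -- One `X` and fifteen `Y`s for each original cell.
    total : length (xs ++ ys) ≡ 16 * extent (tape l a r)
    total = begin
      length (xs ++ ys)                  ≡⟨ length-++ xs ⟩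
      length xs + length ys              ≡⟨ cong₂ _+_ (length-replicate (length us)) len ⟩
      length us + (length us * 15 + 0)   ≡⟨ solve 1 (λ u → u :+ (u :* con 15 :+ con 0) := con 16 :* u) refl (length us) ⟩
      16 * length us                     ≡⟨ cong (16 *_) length-us ⟩
      16 * extent (tape l a r)           ∎
      where
      open ≡-Reasoning
      open +-*-Solver
    ones : map (const (raw 2F)) (xs ++ ys) ≡ replicate (16 * extent (tape l a r)) (raw 2F)
    ones = trans (map-const (raw 2F) (xs ++ ys)) (cong (λ n → replicate n (raw 2F)) total)
    toLeftEnd : (rewind , tape l a r) ⟶ (rewind , tape [] ◻ us)
    toLeftEnd = departing (cong (λ v → unload ◻ v r) (ʳ++-involutive (a ∷ l)))
      (sweepL-id rewind ((a ∷ l) ʳ++ []) [] r (All.map (if-false ∘ blank-plain _) (All-ʳ++ (p ∷ ps) [])))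
    path : (rewind , tape l a r) ⟶ (stop , load ◻ (◻ ∷ []) (replicate (16 * extent (tape l a r)) (raw 2F) ++ ◻ ∷ []))
    path = toLeftEnd
      then one {rewind} {tape [] ◻ us} refl
      then departing (cong (load ◻ (◻ ∷ [])) (++-identityʳ us)) s
      then arriving (cong (λ v → load ◻ (◻ ∷ []) (v ++ ◻ ∷ [])) ones) (wrapUp (length us) ys ysY)

-- Compiling the combined machine

module Combine (M₁ M₂ : TM) {F : Set} (finF : Finite F) (start : F)
  (finish : Verdict → Verdict → Trans F (Dual.Symbol M₁ M₂)) where
  open Dual M₁ M₂
  open Compile (finite-Composite (TM.nΓ M₁) (TM.nΓ M₂)) (finite-State finF start finish)
    (inj₁ false) (dual finF start finish) public

  Combined : List (Fin 4) → ℕ → ℕ → Set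
  Combined w t₁ t₂ = ∃ λ T → (All Plain (left T) × Plain (head T) × All Plain (right T))
    × length (output M₁ c₁) ≤ extent T × length (output M₂ c₂) ≤ extent T
    × (∀ {u q' T'} → Halts ◻ (finish (verdict (tapeOf M₁ c₁)) (verdict (tapeOf M₂ c₂))) start T u q' T'
        → ∀ t → 2 * t₁ + 2 * t₂ + (10 + u) ≤ t
        → let c = exec machine t (initial machine (map (_↑ˡ TM.nΓ machine) w))
          in Halted machine c × mapT glyph (tapeOf machine c) ≡ T')
    where
    c₁ = exec M₁ t₁ (initial M₁ (map (_↑ˡ TM.nΓ M₁) w))
    c₂ = exec M₂ t₂ (initial M₂ (map (_↑ˡ TM.nΓ M₂) w))

  combine-Halts : ∀ w {t₁ t₂} → All (λ (i : Fin 4) → ¬ i ≡ 0F) w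
    → HaltsWithin M₁ t₁ (map (_↑ˡ TM.nΓ M₁) w) → HaltsWithin M₂ t₂ (map (_↑ˡ TM.nΓ M₂) w)
    → Combined w t₁ t₂
  combine-Halts w {t₁} {t₂} nz h₁ h₂ =
    assemble (initial-Halts M₁ t₁ _ h₁) (initial-Halts M₂ t₂ _ h₂)
    where
    c₁ = exec M₁ t₁ (initial M₁ (map (_↑ˡ TM.nΓ M₁) w))
    c₂ = exec M₂ t₂ (initial M₂ (map (_↑ˡ TM.nΓ M₂) w))
    assemble : (∃ λ t' → t' ≤ t₁ × ∃ λ q → Halts zero (TM.δ M₁) zero _ t' q (tapeOf M₁ c₁))
      → (∃ λ t' → t' ≤ t₂ × ∃ λ q → Halts zero (TM.δ M₂) zero _ t' q (tapeOf M₂ c₂)) → _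
    assemble (s₁ , s₁≤ , _ , r₁) (s₂ , s₂≤ , _ , r₂) = conclude (dual-Halts finF start finish w nz r₁ r₂)
      where
      conclude : _ → _
      conclude (T , plain , room₁ , room₂ , continue) = T , plain ,
        subst (λ o → length o ≤ extent T) (sym (output-contents M₁ c₁)) room₁ ,
        subst (λ o → length o ≤ extent T) (sym (output-contents M₂ c₂)) room₂ ,
        λ {u} {_} {_} h t bound → finishing u t bound (continue h)
        where
        finishing : ∀ u t {T'} → 2 * t₁ + 2 * t₂ + (10 + u) ≤ t
          → (∃ λ t' → ∃ λ q → t' ≤ 2 * s₁ + 2 * s₂ + (10 + u)
              × Halts ◻ (dual finF start finish) (inj₁ false) (load ◻ [] (map raw w)) t' q T') → _
        -- The true running times `s₁` and `s₂` are below the allowances `t₁` and `t₂`, and the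
        -- compiled machine idles for the remaining steps.
        finishing u t bound (t' , q , t'≤ , r) = Halts-machine w r (≤-trans t'≤ (≤-trans
          (+-monoˡ-≤ (10 + u) (+-mono-≤ (*-monoʳ-≤ 2 s₁≤) (*-monoʳ-≤ 2 s₂≤))) bound))

-- Closure properties of FPT

-- Inputs are written over the four symbols common to all alphabets, so one word serves both given
-- machines and the combined one.
bitCode : Bool → Fin 4
bitCode false = 1F
bitCode true  = 2F

bitCode≢0 : ∀ bs → All (λ (i : Fin 4) → ¬ i ≡ 0F) (map bitCode bs)
bitCode≢0 []           = []
bitCode≢0 (false ∷ bs) = (λ ()) ∷ bitCode≢0 bs
bitCode≢0 (true ∷ bs)  = (λ ()) ∷ bitCode≢0 bs

bits-bitCode : ∀ M bs → bits M bs ≡ map (_↑ˡ TM.nΓ M) (map bitCode bs)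
bits-bitCode M []           = refl
bits-bitCode M (false ∷ bs) = cong (_ ∷_) (bits-bitCode M bs)
bits-bitCode M (true ∷ bs)  = cong (_ ∷_) (bits-bitCode M bs)

-- `Computable` demands exactly `f k` ones, so `f` is not fixed beforehand but read off the run: `m`
-- is the extent of the tape on which `stretch` starts.
computable-dominating : ∀ Ω {f₁ f₂} → Computable Ω f₁ → Computable Ω f₂
  → ∃ λ f → Computable Ω f × ∀ k → ∃ λ m → f k ≡ 16 * m × 1 ≤ m × f₁ k ≤ m × f₂ k ≤ m
computable-dominating Ω {f₁} {f₂} (M₁ , h₁) (M₂ , h₂) =
  (λ k → 16 * proj₁ (value k)) , (machine , λ k → proj₂ (proj₂ (value k))) ,
  λ k → proj₁ (value k) , refl , proj₁ (proj₂ (value k))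
  where
  open Dual M₁ M₂
  open Combine M₁ M₂ (finite-⊎ (finite-Fin 7) (finite-Fin 15)) rewind (λ _ _ → stretch)

  length-ones : ∀ M c {n} → output M c ≡ replicate n (sym1 M) → length (output M c) ≡ n
  length-ones M c {n} e = trans (cong length e) (length-replicate n)

  cells-load : ∀ l w z → head (load ◻ l (w ++ ◻ ∷ z)) ∷ right (load ◻ l (w ++ ◻ ∷ z)) ≡ w ++ ◻ ∷ z
  cells-load l []      z = refl
  cells-load l (_ ∷ _) z = refl

  Stretched : List (Fin 4) → ℕ → ℕ → Set
  Stretched w n₁ n₂ = ∃ λ m → (1 ≤ m × n₁ ≤ m × n₂ ≤ m)
    × HaltsWith machine (map (_↑ˡ TM.nΓ machine) w) (replicate (16 * m) (sym1 machine))

  output-stretched : ∀ c n → mapT glyph (tapeOf machine c) ≡ load ◻ (◻ ∷ []) (replicate n (raw 2F) ++ ◻ ∷ [])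
    → output machine c ≡ replicate n (sym1 machine)
  output-stretched c n e = trans
    (output-glyph c (replicate n 1F) e (trans (cells-load _ (replicate n (raw 2F)) [])
      (cong (_++ ◻ ∷ []) (sym (map-replicate (raw ∘ suc) n 1F)))))
    (map-replicate _ n 1F)

  stretched : ∀ w {t₁ t₂} → Combined w t₁ t₂
    → Stretched w (length (output M₁ (exec M₁ t₁ (initial M₁ (map (_↑ˡ TM.nΓ M₁) w)))))
                  (length (output M₂ (exec M₂ t₂ (initial M₂ (map (_↑ˡ TM.nΓ M₂) w)))))
  stretched w {t₁} {t₂} (T , plain , room₁ , room₂ , continue) = extent T ,
    -- The extent is positive because it counts the scanned cell.
    (≤-trans (s≤s z≤n) (m≤n+m (suc (length (right T))) (length (left T))) , room₁ , room₂) ,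
    t , proj₁ result , output-stretched (exec machine t (initial machine _)) (16 * extent T) (proj₂ result)
    where
    u = proj₁ (stretch-Halts T plain)
    t = 2 * t₁ + 2 * t₂ + (10 + u)
    result = continue (proj₂ (stretch-Halts T plain)) t ≤-refl

  evaluate : ∀ w {n₁ n₂} → All (λ (i : Fin 4) → ¬ i ≡ 0F) w
    → HaltsWith M₁ (map (_↑ˡ TM.nΓ M₁) w) (replicate n₁ (sym1 M₁))
    → HaltsWith M₂ (map (_↑ˡ TM.nΓ M₂) w) (replicate n₂ (sym1 M₂)) → Stretched w n₁ n₂
  evaluate w nz (t₁ , d₁ , o₁) (t₂ , d₂ , o₂) = subst (Stretched w _) (length-ones M₂ (exec M₂ t₂ _) o₂)
    (subst (λ n → Stretched w n (length (output M₂ (exec M₂ t₂ (initial M₂ _))))) (length-ones M₁ (exec M₁ t₁ _) o₁)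
      (stretched w {t₁} {t₂} (combine-Halts w {t₁} {t₂} nz d₁ d₂)))

  value : ∀ k → ∃ λ m → (1 ≤ m × f₁ k ≤ m × f₂ k ≤ m)
    × HaltsWith machine (bits machine (toList (ParamSpace.enc Ω k))) (replicate (16 * m) (sym1 machine))
  value k = rephrase (evaluate (map bitCode e) (bitCode≢0 e)
    (subst (λ w → HaltsWith M₁ w (replicate (f₁ k) (sym1 M₁))) (bits-bitCode M₁ e) (h₁ k))
    (subst (λ w → HaltsWith M₂ w (replicate (f₂ k) (sym1 M₂))) (bits-bitCode M₂ e) (h₂ k)))
    where
    e = toList (ParamSpace.enc Ω k)
    rephrase : Stretched (map bitCode e) (f₁ k) (f₂ k) → _
    rephrase (m , bounds , h) = m , bounds ,
      subst (λ w → HaltsWith machine w (replicate (16 * m) (sym1 machine))) (sym (bits-bitCode machine e)) h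

pairCode : (Ω : ParamSpace) → ParamSpace.Carrier Ω → Str → List (Fin 4)
pairCode Ω k x = map bitCode (toList (ParamSpace.enc Ω k)) ++ 3F ∷ map bitCode (toList x)

pairCode≢0 : ∀ Ω k x → All (λ (i : Fin 4) → ¬ i ≡ 0F) (pairCode Ω k x)
pairCode≢0 Ω k x = ++⁺ (bitCode≢0 (toList (ParamSpace.enc Ω k))) ((λ ()) ∷ bitCode≢0 (toList x))

pairInput-pairCode : ∀ Ω M k x → pairInput Ω M k x ≡ map (_↑ˡ TM.nΓ M) (pairCode Ω k x)
pairInput-pairCode Ω M k x = trans
  (cong₂ (λ u v → u ++ sep M ∷ v) (bits-bitCode M (toList (ParamSpace.enc Ω k))) (bits-bitCode M (toList x)))
  (sym (map-++ (_↑ˡ TM.nΓ M) (map bitCode (toList (ParamSpace.enc Ω k))) _))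

-- The base is positive, so both powers are at most the one with exponent `c₁ + c₂`, and `1 ≤ m`
-- lets the additive constant be absorbed. The factor 16 is 2 + 2 + 12.
time-bound : ∀ {g₁ g₂ m} n c₁ c₂ → g₁ ≤ m → g₂ ≤ m → 1 ≤ m
  → 2 * (g₁ * suc n ^ c₁) + 2 * (g₂ * suc n ^ c₂) + (10 + 2) ≤ 16 * m * suc n ^ (c₁ + c₂)
time-bound {g₁} {g₂} {m} n c₁ c₂ g₁≤ g₂≤ 1≤m = begin
  2 * (g₁ * suc n ^ c₁) + 2 * (g₂ * suc n ^ c₂) + 12 * 1
    ≤⟨ +-mono-≤ (+-mono-≤ (*-monoʳ-≤ 2 (*-mono-≤ g₁≤ (^-monoʳ-≤ (suc n) (m≤m+n c₁ c₂))))
                          (*-monoʳ-≤ 2 (*-mono-≤ g₂≤ (^-monoʳ-≤ (suc n) (m≤n+m c₂ c₁)))))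
                (*-monoʳ-≤ 12 (*-mono-≤ 1≤m (m^n>0 (suc n) (c₁ + c₂)))) ⟩
  2 * (m * p) + 2 * (m * p) + 12 * (m * p)
    ≡⟨ solve 2 (λ m p → con 2 :* (m :* p) :+ con 2 :* (m :* p) :+ con 12 :* (m :* p)
         := con 16 :* m :* p) refl m p ⟩
  16 * m * p ∎
  where
  p = suc n ^ (c₁ + c₂)
  open ≤-Reasoning
  open +-*-Solver

-- Correctness of the combined answer

Decided : Bool → Set → Set
Decided true  P = P
Decided false P = ¬ P

decided-△ : ∀ {A B : Lang} {x} a b → Decided a (A x) → Decided b (B x) → Decided (a xor b) ((A △ B) x)
decided-△ true  true  p q (inj₁ (_ , nq)) = nq q
decided-△ true  true  p q (inj₂ (_ , np)) = np p
decided-△ true  false p q = inj₁ (p , q)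
decided-△ false true  p q = inj₂ (q , p)
decided-△ false false p q (inj₁ (r , _)) = p r
decided-△ false false p q (inj₂ (r , _)) = q r

record Correct (A : Set) (D : Set) (v : Verdict) : Set where
  field
    sound   : ∀ b → v ≡ just b → Decided b A
    defined : D ⇔ ∃ λ b → v ≡ just b

-- Both verdicts are defined exactly on the same `D`, so their exclusive or is defined there too,
-- and definedness of either one gives membership in `D`.
correct-△ : ∀ {A B : Lang} {x D v w} → Correct (A x) D v → Correct (B x) D w
  → Correct ((A △ B) x) D (zipWith _xor_ v w)
correct-△ {A} {B} {x} {D} {v} {w} p q = record
  { sound   = sound v w (Correct.sound p) (Correct.sound q)
  ; defined = mk⇔
      (λ d → both v w (Equivalence.to (Correct.defined p) d) (Equivalence.to (Correct.defined q) d))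
      (λ e → Equivalence.from (Correct.defined p) (left-defined v w e))
  }
  where
  sound : ∀ v w → (∀ b → v ≡ just b → Decided b (A x)) → (∀ b → w ≡ just b → Decided b (B x))
    → ∀ b → zipWith _xor_ v w ≡ just b → Decided b ((A △ B) x)
  sound (just a) (just b) p q _ refl = decided-△ {A} {B} a b (p a refl) (q b refl)
  both : ∀ v w → (∃ λ b → v ≡ just b) → (∃ λ b → w ≡ just b) → ∃ λ b → zipWith _xor_ v w ≡ just b
  both _ _ (_ , refl) (_ , refl) = _ , refl
  left-defined : ∀ v w → (∃ λ b → zipWith _xor_ v w ≡ just b) → ∃ λ b → v ≡ just b
  left-defined (just a) w _ = a , refl

FPTOutput : (M : TM) (A D : Set) → List (Sym M) → Set
FPTOutput M A D out = (out ≡ sym1 M ∷ [] → A) × (out ≡ sym0 M ∷ [] → ¬ A)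
  × (D ⇔ (out ≡ sym0 M ∷ [] ⊎ out ≡ sym1 M ∷ []))

-- Read forwards for the two given machines and backwards for the combined one, so that the argument
-- about symmetric differences involves verdicts only.
FPTOutput⇔Correct : ∀ M {A D out v} → (∀ b → out ≡ bit M b ∷ [] ⇔ v ≡ just b)
  → FPTOutput M A D out ⇔ Correct A D v
FPTOutput⇔Correct M {A} {D} {out} {v} e = mk⇔ to from
  where
  module E b = Equivalence (e b)
  to : FPTOutput M A D out → Correct A D v
  to (yes , no , d) = record
    { sound   = λ { true eq → yes (E.from true eq) ; false eq → no (E.from false eq) }
    ; defined = mk⇔
        ([ (λ eq → false , E.to false eq) , (λ eq → true , E.to true eq) ] ∘ Equivalence.to d)
        (λ { (false , eq) → Equivalence.from d (inj₁ (E.from false eq))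
           ; (true  , eq) → Equivalence.from d (inj₂ (E.from true eq)) })
    }
  from : Correct A D v → FPTOutput M A D out
  from c = (λ eq → sound true (E.to true eq)) , (λ eq → sound false (E.to false eq)) , mk⇔
    (λ d → answer (Equivalence.to defined d))
    [ (λ eq → Equivalence.from defined (false , E.to false eq))
    , (λ eq → Equivalence.from defined (true , E.to true eq)) ]
    where
    open Correct c
    answer : (∃ λ b → v ≡ just b) → out ≡ sym0 M ∷ [] ⊎ out ≡ sym1 M ∷ []
    answer (false , eq) = inj₁ (E.from false eq)
    answer (true  , eq) = inj₂ (E.from true eq)

FPT-△ : ∀ Ω {A B : Lang} {η} → FPT Ω A η → FPT Ω B η → FPT Ω (A △ B) η
FPT-△ Ω {A} {B} {η} (c₁ , M₁ , f₁ , comp₁ , h₁) (c₂ , M₂ , f₂ , comp₂ , h₂) =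
  c₁ + c₂ , machine , proj₁ dominating , proj₁ (proj₂ dominating) , solves
  where
  open Dual M₁ M₂
  open Combine M₁ M₂ (finite-Fin 3) 0F announce
  dominating = computable-dominating Ω comp₁ comp₂

  Answers : (M : TM) → Lang → ℕ → ParamSpace.Carrier Ω → Str → List (Sym M) → Set
  Answers M C t k x w = HaltsWithin M t w
    × FPTOutput M (C x) (Parameterization.rel η x k) (output M (exec M t (initial M w)))

  output⇔conclusion : ∀ c v {l r} → mapT glyph (tapeOf machine c) ≡ tape l (raw (suc (conclusion v))) (◻ ∷ r)
    → ∀ b → output machine c ≡ bit machine b ∷ [] ⇔ v ≡ just b
  output⇔conclusion c v e b
    rewrite output-glyph c (conclusion v ∷ []) e refl = mk⇔ (to v b) (from v b)
    where
    to : ∀ v b → (suc (conclusion v) ↑ˡ _) ∷ [] ≡ bit machine b ∷ [] → v ≡ just b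
    to (just false) false _ = refl
    to (just true)  true  _ = refl
    to (just false) true  ()
    to (just true)  false ()
    to nothing      true  ()
    to nothing      false ()
    from : ∀ v b → v ≡ just b → (suc (conclusion v) ↑ˡ _) ∷ [] ≡ bit machine b ∷ []
    from _ false refl = refl
    from _ true  refl = refl

  combined : ∀ k x {t₁ t₂ t} → 2 * t₁ + 2 * t₂ + (10 + 2) ≤ t
    → Answers M₁ A t₁ k x (map (_↑ˡ TM.nΓ M₁) (pairCode Ω k x))
    → Answers M₂ B t₂ k x (map (_↑ˡ TM.nΓ M₂) (pairCode Ω k x))
    → Answers machine (A △ B) t k x (map (_↑ˡ TM.nΓ machine) (pairCode Ω k x))
  combined k x {t₁} {t₂} {t} bound (d₁ , a₁) (d₂ , a₂) =
    conclude (combine-Halts (pairCode Ω k x) {t₁} {t₂} (pairCode≢0 Ω k x) d₁ d₂)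
    where
    e₁ = exec M₁ t₁ (initial M₁ (map (_↑ˡ TM.nΓ M₁) (pairCode Ω k x)))
    e₂ = exec M₂ t₂ (initial M₂ (map (_↑ˡ TM.nΓ M₂) (pairCode Ω k x)))
    e  = exec machine t (initial machine (map (_↑ˡ TM.nΓ machine) (pairCode Ω k x)))
    v₁ = verdict (tapeOf M₁ e₁)
    v₂ = verdict (tapeOf M₂ e₂)
    correct : Correct ((A △ B) x) (Parameterization.rel η x k) (zipWith _xor_ v₁ v₂)
    correct = correct-△ {A} {B}
      (Equivalence.to (FPTOutput⇔Correct M₁ (output⇔verdict M₁ e₁)) a₁)
      (Equivalence.to (FPTOutput⇔Correct M₂ (output⇔verdict M₂ e₂)) a₂)
    conclude : Combined (pairCode Ω k x) t₁ t₂
      → Answers machine (A △ B) t k x (map (_↑ˡ TM.nΓ machine) (pairCode Ω k x))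
    conclude (T , _ , _ , _ , continue) = proj₁ result ,
      Equivalence.from (FPTOutput⇔Correct machine (output⇔conclusion e _ (proj₂ result))) correct
      where
      -- `announce` takes two steps, whence the `10 + 2` in `bound`.
      result = continue (proj₂ (proj₂ (announce-Halts v₁ v₂ T))) t bound

  solves : ∀ k x → Answers machine (A △ B) (proj₁ dominating k * ∣ x ∣ₛ ^ (c₁ + c₂)) k x (pairInput Ω machine k x)
  solves k x = subst (Answers machine (A △ B) t k x) (sym (pairInput-pairCode Ω machine k x))
    (combined k x {t₁} {t₂} {t} (bound (proj₂ (proj₂ dominating) k))
      (subst (Answers M₁ A t₁ k x) (pairInput-pairCode Ω M₁ k x) (h₁ k x))
      (subst (Answers M₂ B t₂ k x) (pairInput-pairCode Ω M₂ k x) (h₂ k x)))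
    where
    t₁ = f₁ k * ∣ x ∣ₛ ^ c₁
    t₂ = f₂ k * ∣ x ∣ₛ ^ c₂
    t  = proj₁ dominating k * ∣ x ∣ₛ ^ (c₁ + c₂)
    bound : (∃ λ m → proj₁ dominating k ≡ 16 * m × 1 ≤ m × f₁ k ≤ m × f₂ k ≤ m)
      → 2 * t₁ + 2 * t₂ + (10 + 2) ≤ t
    bound (m , e , 1≤m , p , q) =
      subst (λ g → 2 * t₁ + 2 * t₂ + (10 + 2) ≤ g * ∣ x ∣ₛ ^ (c₁ + c₂)) (sym e)
        -- Strings are nonempty, so the length of `x` is the successor of its predecessor by
        -- computation.
        (time-bound (pred ∣ x ∣ₛ) c₁ c₂ p q 1≤m)

theorem19 : (Ω : ParamSpace) (A B : Lang)
    → (∀ (η : Parameterization Ω) → FPT Ω A η ⇔ FPT Ω B η)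
    → ∀ (η : Parameterization Ω) → FPT Ω A η → FPT Ω (A △ B) η
theorem19 Ω A B same η a = FPT-△ Ω {η = η} a (Equivalence.to (same η) a)
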